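{- Let $k\in\mathbb{N}_+$. There is a deterministic dynamic algorithm (the Greedy algorithm) that maintains a $\left(1+2\frac{\sqrt{3}}{3}\approx 2.155\right)$-approximation of a maximum $k$-edge coloring of a dynamic graph in $O(\Delta)$ update time, where $\Delta$ is the maximum vertex degree of the current graph.
   Context: A dynamic graph is an undirected, unweighted simple graph $G=(V,E)$ that undergoes an a priori unknown sequence of edge insertions and edge deletions (updates). The update time is the time needed to process an update before accepting the next one. A $k$-edge coloring of $G$ is a map $f:E\to[k]\cup\{\bot\}$ that is proper: any two adjacent edges $e,e'$ satisfy $f(e)\ne f(e')$ or $f(e)=f(e')=\bot$. Edges with $f(e)\in[k]$ are colored, the others uncolored. The maximum $k$-edge coloring problem asks for such an $f$ maximizing the number $|f^{ -1}([k])|$ of colored edges. $f$ is a $\gamma$-approximation if $\gamma\cdot|f^{ -1}([k])|\ge|f^{*-1}([k])|$ for an optimal coloring $f^*$. The Greedy algorithm: when an edge is inserted, it is colored with a color free at both its endpoints (no incident edge has this color) if such a color exists, and left uncolored otherwise; when an edge of color $c$ is deleted, the algorithm tries, for each of its two endpoints, to color one uncolored edge incident to it with color $c$. -}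

module Defs where

open import Level using (0ℓ)
open import Data.Bool using (Bool; true; false; not; _∧_; _∨_; if_then_else_)
open import Data.Empty using (⊥)
open import Data.Nat using (ℕ; suc; pred; _+_; _≤_; _≡ᵇ_; _≤ᵇ_)
open import Data.Fin using (Fin; toℕ)
open import Data.Fin.Properties using () renaming (_≟_ to _≟ᶠ_; _<?_ to _<ᶠ?_)
open import Data.Integer using (+_)
open import Data.List using (length; filter; map; allFin; cartesianProduct)
open import Data.List.Extrema.Nat using (max)
open import Data.Maybe using (Maybe; just; nothing; is-just)
open import Data.Product using (∃-syntax; _×_; _,_; swap)
open import Data.Rational as ℚ using (ℚ; 0ℚ; 1ℚ)
open import Data.Sum as Sum using (_⊎_; inj₁; inj₂)
open import Relation.Binary using (Rel; Decidable; Symmetric)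
open import Relation.Binary.PropositionalEquality using (_≡_; _≢_; refl; sym; trans)
open import Relation.Nullary using (¬_; Dec; does; yes; no; ¬?; _×-dec_; _⊎-dec_)
open import Relation.Nullary.Decidable using (T?)

------------------------------------------------------------------------
-- Real factors

-- A real number γ, given by the set of rationals strictly above it
-- (the upper half of its Dedekind cut).
UpperCut : Set₁
UpperCut = ℚ → Set

√3 : UpperCut
√3 r = (0ℚ ℚ.< r) × ((+ 3 ℚ./ 1) ℚ.< r ℚ.* r)

1+2√3/3 : UpperCut
1+2√3/3 q = ∃[ r ] (√3 r × q ≡ 1ℚ ℚ.+ (+ 2 ℚ./ 1) ℚ.* (r ℚ.* (+ 1 ℚ./ 3)))

-- γ · a ≥ b in the reals: as a is nonnegative, γ · a is the infimum of
-- the numbers q · a over the rationals q above γ.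
_·_≥_ : UpperCut → ℕ → ℕ → Set
γ · a ≥ b = ∀ q → γ q → (+ b ℚ./ 1) ℚ.≤ q ℚ.* (+ a ℚ./ 1)

------------------------------------------------------------------------
-- Simple graphs on a fixed finite vertex set

record Graph (n : ℕ) : Set₁ where
  field
    Adj     : Rel (Fin n) 0ℓ
    adj?    : Decidable Adj
    adj-sym : Symmetric Adj
    irrefl  : ∀ {u} → ¬ Adj u u

open Graph public

degree : ∀ {n} → Graph n → Fin n → ℕ
degree {n} G u = length (filter (adj? G u) (allFin n))

Δ : ∀ {n} → Graph n → ℕ
Δ {n} G = max 0 (map (degree G) (allFin n))

emptyGraph : ∀ {n} → Graph n
emptyGraph .Adj _ _ = ⊥
emptyGraph .adj? _ _ = no λ ()
emptyGraph .adj-sym ()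
emptyGraph .irrefl ()

-- The pairs (u , v) and (x , y) denote the same undirected edge.
SameEdge : ∀ {n} → Fin n → Fin n → Fin n → Fin n → Set
SameEdge u v x y = (x ≡ u × y ≡ v) ⊎ (x ≡ v × y ≡ u)

sameEdge? : ∀ {n} (u v x y : Fin n) → Dec (SameEdge u v x y)
sameEdge? u v x y = ((x ≟ᶠ u) ×-dec (y ≟ᶠ v)) ⊎-dec ((x ≟ᶠ v) ×-dec (y ≟ᶠ u))

sameEdge-sym : ∀ {n} {u v x y : Fin n} → SameEdge u v x y → SameEdge u v y x
sameEdge-sym e = Sum.map swap swap (Sum.swap e)

data Update {n} (G : Graph n) : Set where
  insert : (u v : Fin n) → u ≢ v → ¬ Adj G u v → Update G
  delete : (u v : Fin n) → Adj G u v → Update G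

infixl 5 _▷_

_▷_ : ∀ {n} (G : Graph n) → Update G → Graph n
(G ▷ insert u v u≢v _) .Adj x y = Adj G x y ⊎ SameEdge u v x y
(G ▷ insert u v u≢v _) .adj? x y = adj? G x y ⊎-dec sameEdge? u v x y
(G ▷ insert u v u≢v _) .adj-sym = Sum.map (adj-sym G) sameEdge-sym
(G ▷ insert u v u≢v _) .irrefl (inj₁ a) = irrefl G a
(G ▷ insert u v u≢v _) .irrefl (inj₂ (inj₁ (p , q))) = u≢v (trans (sym p) q)
(G ▷ insert u v u≢v _) .irrefl (inj₂ (inj₂ (p , q))) = u≢v (trans (sym q) p)
(G ▷ delete u v _) .Adj x y = Adj G x y × ¬ SameEdge u v x y
(G ▷ delete u v _) .adj? x y = adj? G x y ×-dec ¬? (sameEdge? u v x y)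
(G ▷ delete u v _) .adj-sym (a , ¬e) = adj-sym G a , λ e → ¬e (sameEdge-sym e)
(G ▷ delete u v _) .irrefl (a , _) = irrefl G a

------------------------------------------------------------------------
-- Edge colorings

-- A symmetric colour table on pairs of vertices; nothing stands for ⊥.
Table : ℕ → ℕ → Set
Table k n = Fin n → Fin n → Maybe (Fin k)

infix 4 _≈_

_≈_ : ∀ {k n} → Table k n → Table k n → Set
f ≈ g = ∀ u v → f u v ≡ g u v

-- Fixing the value ⊥ off the edges makes these tables correspond
-- exactly to the proper maps E → [k] ∪ {⊥}.
record EdgeColoring (k : ℕ) {n} (G : Graph n) : Set where
  field
    color     : Table k n
    color-sym : ∀ u v → color u v ≡ color v u
    off-edges : ∀ u v → ¬ Adj G u v → color u v ≡ nothing
    proper    : ∀ u v w → Adj G u v → Adj G u w → v ≢ w →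
                color u v ≢ color u w ⊎ (color u v ≡ nothing × color u w ≡ nothing)

open EdgeColoring public

-- Each edge is counted once, as the pair (u , v) with u < v.
#colored : ∀ {k n} {G : Graph n} → EdgeColoring k G → ℕ
#colored {n = n} f =
  length (filter (λ (u , v) → (u <ᶠ? v) ×-dec T? (is-just (color f u v)))
                 (cartesianProduct (allFin n) (allFin n)))

IsMaximum : ∀ {k n} {G : Graph n} → EdgeColoring k G → Set
IsMaximum {k} {G = G} f = ∀ (g : EdgeColoring k G) → #colored g ≤ #colored f

IsApproximation : UpperCut → ∀ {k n} {G : Graph n} → EdgeColoring k G → Set
IsApproximation γ {k} {G = G} f =
  ∀ (f* : EdgeColoring k G) → IsMaximum f* → γ · #colored f ≥ #colored f*

------------------------------------------------------------------------
-- The Greedy algorithm, as a relation between successive colorings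

Free : ∀ {k n} → Table k n → Fin k → Fin n → Set
Free f c u = ∀ v → f u v ≢ just c

assign : ∀ {k n} → Fin n → Fin n → Maybe (Fin k) → Table k n → Table k n
assign u v m f x y = if does (sameEdge? u v x y) then m else f x y

-- Trying to give colour c to one uncolored edge of G incident to u.
data TryColor {k n} (G : Graph n) (c : Fin k) (u : Fin n) (f f′ : Table k n) : Set where
  success : ∀ w → Adj G u w → f u w ≡ nothing → Free f c u → Free f c w →
            f′ ≈ assign u w (just c) f → TryColor G c u f f′
  failure : (∀ w → Adj G u w → f u w ≡ nothing → ¬ (Free f c u × Free f c w)) →
            f′ ≈ f → TryColor G c u f f′

data GreedyStep {k n} {G : Graph n} : Update G → Table k n → Table k n → Set where
  insert-colored : ∀ {u v u≢v ¬a f f′} c → Free f c u → Free f c v →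
                   f′ ≈ assign u v (just c) f →
                   GreedyStep (insert u v u≢v ¬a) f f′
  insert-uncolored : ∀ {u v u≢v ¬a f f′} → (∀ c → ¬ (Free f c u × Free f c v)) →
                     f′ ≈ f →
                     GreedyStep (insert u v u≢v ¬a) f f′
  delete-colored : ∀ {u v a f f′} c g → f u v ≡ just c →
                   TryColor (G ▷ delete u v a) c u (assign u v nothing f) g →
                   TryColor (G ▷ delete u v a) c v g f′ →
                   GreedyStep (delete u v a) f f′
  delete-uncolored : ∀ {u v a f f′} → f u v ≡ nothing → f′ ≈ f →
                     GreedyStep (delete u v a) f f′

------------------------------------------------------------------------
-- Machine model: while programs over registers and two-dimensional
-- arrays of natural numbers, with random access.  The only arithmetic is
-- adding or subtracting one, so that numbers grow by at most a constant per
-- step and large amounts of data cannot be packed into one cell.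

Reg Arr : Set
Reg = ℕ
Arr = ℕ

data Expr : Set where
  lit     : ℕ → Expr
  reg     : Reg → Expr
  _[_,_]  : Arr → Expr → Expr → Expr
  inc dec : Expr → Expr

data Test : Set where
  _==_ _<=_ : Expr → Expr → Test
  neg       : Test → Test
  _and_     : Test → Test → Test
  _or_      : Test → Test → Test

infixr 4 _⨟_

data Cmd : Set where
  skip          : Cmd
  _≔_           : Reg → Expr → Cmd
  _[_,_]≔_      : Arr → Expr → Expr → Expr → Cmd
  _⨟_           : Cmd → Cmd → Cmd
  If_Then_Else_ : Test → Cmd → Cmd → Cmd
  While_Do_     : Test → Cmd → Cmd

record State : Set where
  constructor ⟨_,_⟩
  field
    regs : Reg → ℕ
    mem  : Arr → ℕ → ℕ → ℕ

open State public

setReg : Reg → ℕ → State → State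
setReg r m s .regs q = if q ≡ᵇ r then m else regs s q
setReg r m s .mem = mem s

setMem : Arr → ℕ → ℕ → ℕ → State → State
setMem a i j m s .regs = regs s
setMem a i j m s .mem b x y =
  if (b ≡ᵇ a) ∧ (x ≡ᵇ i) ∧ (y ≡ᵇ j) then m else mem s b x y

evalE : Expr → State → ℕ
evalE (lit m) s = m
evalE (reg r) s = regs s r
evalE (a [ e , e′ ]) s = mem s a (evalE e s) (evalE e′ s)
evalE (inc e) s = suc (evalE e s)
evalE (dec e) s = pred (evalE e s)

evalT : Test → State → Bool
evalT (e == e′) s = evalE e s ≡ᵇ evalE e′ s
evalT (e <= e′) s = evalE e s ≤ᵇ evalE e′ s
evalT (neg b) s = not (evalT b s)
evalT (b and b′) s = evalT b s ∧ evalT b′ s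
evalT (b or b′) s = evalT b s ∨ evalT b′ s

-- c , s ⇓ s′ , t: the run of c from s halts in s′ after t steps.  Every
-- assignment and every evaluation of a test is one step; expressions and
-- tests are part of the program text and hence of constant size.
infix 3 _,_⇓_,_

data _,_⇓_,_ : Cmd → State → State → ℕ → Set where
  ⇓-skip    : ∀ {s} → skip , s ⇓ s , 1
  ⇓-reg     : ∀ {r e s} → (r ≔ e) , s ⇓ setReg r (evalE e s) s , 1
  ⇓-mem     : ∀ {a i j e s} →
              (a [ i , j ]≔ e) , s ⇓ setMem a (evalE i s) (evalE j s) (evalE e s) s , 1
  ⇓-seq     : ∀ {c d s s′ s″ t t′} → c , s ⇓ s′ , t → d , s′ ⇓ s″ , t′ →
              (c ⨟ d) , s ⇓ s″ , t + t′
  ⇓-true    : ∀ {b c d s s′ t} → evalT b s ≡ true → c , s ⇓ s′ , t →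
              (If b Then c Else d) , s ⇓ s′ , suc t
  ⇓-false   : ∀ {b c d s s′ t} → evalT b s ≡ false → d , s ⇓ s′ , t →
              (If b Then c Else d) , s ⇓ s′ , suc t
  ⇓-exit    : ∀ {b c s} → evalT b s ≡ false → (While b Do c) , s ⇓ s , 1
  ⇓-iterate : ∀ {b c s s′ s″ t t′} → evalT b s ≡ true → c , s ⇓ s′ , t →
              (While b Do c) , s′ ⇓ s″ , t′ →
              (While b Do c) , s ⇓ s″ , suc (t + t′)

private
  true≢false : ∀ {b} {A : Set} → b ≡ true → b ≡ false → A
  true≢false refl ()

⇓-deterministic : ∀ {c s s₁ s₂ t₁ t₂} → c , s ⇓ s₁ , t₁ → c , s ⇓ s₂ , t₂ →
                  s₁ ≡ s₂ × t₁ ≡ t₂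
⇓-deterministic ⇓-skip ⇓-skip = refl , refl
⇓-deterministic ⇓-reg ⇓-reg = refl , refl
⇓-deterministic ⇓-mem ⇓-mem = refl , refl
⇓-deterministic (⇓-seq p q) (⇓-seq p′ q′) with ⇓-deterministic p p′
... | refl , refl with ⇓-deterministic q q′
... | refl , refl = refl , refl
⇓-deterministic (⇓-true _ p) (⇓-true _ p′) with ⇓-deterministic p p′
... | refl , refl = refl , refl
⇓-deterministic (⇓-true b _) (⇓-false b′ _) = true≢false b b′
⇓-deterministic (⇓-false b _) (⇓-true b′ _) = true≢false b′ b
⇓-deterministic (⇓-false _ p) (⇓-false _ p′) with ⇓-deterministic p p′
... | refl , refl = refl , refl
⇓-deterministic (⇓-exit _) (⇓-exit _) = refl , refl
⇓-deterministic (⇓-exit b) (⇓-iterate b′ _ _) = true≢false b′ b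
⇓-deterministic (⇓-iterate b _ _) (⇓-exit b′) = true≢false b b′
⇓-deterministic (⇓-iterate _ p q) (⇓-iterate _ p′ q′) with ⇓-deterministic p p′
... | refl , refl with ⇓-deterministic q q′
... | refl , refl = refl , refl

------------------------------------------------------------------------
-- Dynamic algorithms

record DynamicAlgorithm : Set where
  field
    onInsert onDelete : Cmd

open DynamicAlgorithm public

-- Register 0 initially holds k and register 1 holds n; everything else
-- is zero.
initial : ℕ → ℕ → State
initial k n = setReg 0 k (setReg 1 n ⟨ (λ _ → 0) , (λ _ _ _ → 0) ⟩)

-- The endpoints of the updated edge are passed in registers 2 and 3.
load : ∀ {n} → Fin n → Fin n → State → State
load u v s = setReg 2 (toℕ u) (setReg 3 (toℕ v) s)

Process : ∀ {n} {G : Graph n} → DynamicAlgorithm → Update G → State → State → ℕ → Set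
Process alg (insert u v _ _) s s′ t = onInsert alg , load u v s ⇓ s′ , t
Process alg (delete u v _)   s s′ t = onDelete alg , load u v s ⇓ s′ , t

-- The graphs and machine states that can occur together, over all
-- sequences of updates of an initially empty graph.
data Reachable (alg : DynamicAlgorithm) (k n : ℕ) : Graph n → State → Set₁ where
  start : Reachable alg k n emptyGraph (initial k n)
  next  : ∀ {G s s′ t} → Reachable alg k n G s → (x : Update G) →
          Process alg x s s′ t → Reachable alg k n (G ▷ x) s′

encode : ∀ {k} → Maybe (Fin k) → ℕ
encode nothing  = 0
encode (just c) = suc (toℕ c)

-- The coloring is output in array 0.
Represents : ∀ {k n} {G : Graph n} → State → EdgeColoring k G → Set
Represents s f = ∀ u v → mem s 0 (toℕ u) (toℕ v) ≡ encode (color f u v)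

{-# OPTIONS --safe #-}

-- A greedy colouring f is maximal: no uncoloured edge uv has a colour free at
-- both ends, so the coloured degrees satisfy c u + c v ≥ k.  This alone gives the
-- factor γ = 1 + 2/√3.  At a vertex let p and q be the numbers of edges of the
-- optimal colouring that f colours and leaves uncoloured, so p ≤ c and p + q ≤ k.
-- With x = c/k, let h x = γ x − 1 for x ≥ 1/2 and h x = γ x + 1 − γ for x < 1/2.
-- Then h x + h y ≥ 0 whenever x + y ≥ 1, whence Σ q h ≥ 0 by summing over the
-- edges that only the optimum colours, while p + q + q h x ≤ γ c at each vertex;
-- for x < 1/2 the latter comes down to 2 − x ≤ γ (1 − x + x²), which holds for all
-- x exactly when γ ≥ 1 + 2/√3.  Summing over all vertices compares the degrees.
--
-- For the update time, the scan for a free colour at u and v only passes colours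
-- used at u or v, hence at most 2Δ of them, and the scan for an edge to recolour
-- goes through one adjacency list.

module Submission where

open import Defs
open import Data.Bool using (T; true; false; if_then_else_; _∧_)
open import Data.Empty using (⊥; ⊥-elim)
open import Data.Fin as F using (Fin; zero; suc; toℕ; fromℕ<; inject≤)
import Data.Fin.Properties as Fin
open import Data.Integer as ℤ using (-[1+_])
import Data.Integer.Properties as ℤₚ
open import Data.List using (length; filter; map; allFin; tabulate; cartesianProduct; _++_)
open import Data.List.Extrema.Nat using (xs≤max)
open import Data.List.Membership.Propositional.Properties using (∈-allFin; ∈-map⁺)
import Data.List.Properties as List
import Data.List.Relation.Unary.All as All
open import Data.Maybe using (Maybe; just; nothing; is-just)
open import Data.Maybe.Properties using (just-injective; ≡-dec)
open import Data.Nat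
open import Data.Nat.Properties
open import Data.Nat.Tactic.RingSolver using (solve-∀)
open import Data.Product using (∃-syntax; _×_; _,_; proj₁; proj₂)
open import Data.Rational as ℚ using (ℚ; mkℚ)
import Data.Rational.Properties as ℚₚ
open import Data.Rational.Unnormalised as ℚᵘ using (ℚᵘ; mkℚᵘ)
import Data.Rational.Unnormalised.Properties as ℚᵘₚ
open import Data.Sum using (_⊎_; inj₁; inj₂; [_,_]′)
open import Data.Unit using (tt)
open import Function using (_∘_; id)
open import Relation.Binary using (tri<; tri≈; tri>)
open import Relation.Binary.PropositionalEquality hiding ([_])
open import Relation.Nullary using (¬_; Dec; does; yes; no; ¬?; _×-dec_)
open import Relation.Nullary.Decidable using (T?; dec-true; dec-false; decidable-stable)
open import Relation.Unary using (Decidable)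

open import Algebra.Properties.Semiring.Sum +-*-semiring
  using (sum; ∑-comm; ∑-distrib-+; sum-cong-≗; *-distribˡ-sum; *-distribʳ-sum)

-- Finite sums and counting

-- The threshold 1 + 2/√3 is the maximum of (2 - x) / (1 - x + x²), attained at x = 2 - √3, which is
-- below 1/2 and so in the range where that bound is needed. The low branch of h is forced: it is -h
-- (1 - x), so that an edge whose coloured degrees sum to exactly k contributes 0. The full strength
-- of the condition on γ enters only in `quadratic`; the other estimates rest on γ ≥ 2.
--
-- The real factor is met only through rationals q above it, and each of these is 1 + 2r/3 with r
-- rational. Writing q = (N + E) / N turns the comparison into one between natural numbers. As h
-- takes both signs, it is split into `gain` and `loss`, and the inequalities are arranged so that
-- terms are added to both sides and cancelled instead of being subtracted.

𝟙 : {P : Set} → Dec P → ℕ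
𝟙 P? = if does P? then 1 else 0

𝟙-yes : {P : Set} (P? : Dec P) → P → 𝟙 P? ≡ 1
𝟙-yes (yes _) _ = refl
𝟙-yes (no ¬p) p = ⊥-elim (¬p p)

𝟙-no : {P : Set} (P? : Dec P) → ¬ P → 𝟙 P? ≡ 0
𝟙-no (yes p) ¬p = ⊥-elim (¬p p)
𝟙-no (no _)  _  = refl

𝟙-mono : {P Q : Set} (P? : Dec P) (Q? : Dec Q) → (P → Q) → 𝟙 P? ≤ 𝟙 Q?
𝟙-mono (yes p) Q? P⇒Q = ≤-reflexive (sym (𝟙-yes Q? (P⇒Q p)))
𝟙-mono (no _)  Q? P⇒Q = z≤n

𝟙≤ : {P : Set} (P? : Dec P) {m : ℕ} → (P → 1 ≤ m) → 𝟙 P? ≤ m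
𝟙≤ (yes p) 1≤m = 1≤m p
𝟙≤ (no _)  1≤m = z≤n

𝟙*-mono : {P : Set} (P? : Dec P) {x y : ℕ} → (P → x ≤ y) → 𝟙 P? * x ≤ 𝟙 P? * y
𝟙*-mono (yes p) x≤y = *-monoʳ-≤ 1 (x≤y p)
𝟙*-mono (no _)  x≤y = z≤n

count : ∀ {n} {P : Fin n → Set} → Decidable P → ℕ
count P? = sum (λ i → 𝟙 (P? i))

sum-mono : ∀ {n} {f g : Fin n → ℕ} → (∀ i → f i ≤ g i) → sum f ≤ sum g
sum-mono {zero}  f≤g = z≤n
sum-mono {suc n} f≤g = +-mono-≤ (f≤g zero) (sum-mono (f≤g ∘ suc))

term≤sum : ∀ {n} (f : Fin n → ℕ) i → f i ≤ sum f
term≤sum f zero    = m≤m+n _ _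
term≤sum f (suc i) = ≤-trans (term≤sum (f ∘ suc) i) (m≤n+m _ _)

sum-zero : ∀ {n} {f : Fin n → ℕ} → (∀ i → f i ≡ 0) → sum f ≡ 0
sum-zero {zero}  f≡0 = refl
sum-zero {suc n} f≡0 = cong₂ _+_ (f≡0 zero) (sum-zero (f≡0 ∘ suc))

sum-ones : ∀ n → sum {n} (λ _ → 1) ≡ n
sum-ones zero    = refl
sum-ones (suc n) = cong suc (sum-ones n)

count-unique≤1 : ∀ {n} {P : Fin n → Set} (P? : Decidable P) →
                 (∀ {i j} → P i → P j → i ≡ j) → count P? ≤ 1
count-unique≤1 {zero}  P? unique = z≤n
count-unique≤1 {suc n} P? unique with P? zero
... | yes p = ≤-reflexive (cong suc (sum-zero λ i → 𝟙-no (P? (suc i)) λ q → Fin.0≢1+n (unique p q)))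
... | no _  = count-unique≤1 (P? ∘ suc) λ p q → Fin.suc-injective (unique p q)

1≤count : ∀ {n} {P : Fin n → Set} (P? : Decidable P) {i} → P i → 1 ≤ count P?
1≤count P? {i} p = ≤-trans (≤-reflexive (sym (𝟙-yes (P? i) p))) (term≤sum _ i)

-- Double counting the pairs of an injective relation.
sum-count≤count :
  ∀ {m n} {R : Fin m → Fin n → Set} {Q : Fin n → Set}
  (R? : ∀ i j → Dec (R i j)) (Q? : Decidable Q) →
  (∀ {i i′ j} → R i j → R i′ j → i ≡ i′) → (∀ {i j} → R i j → Q j) →
  sum (λ i → count (R? i)) ≤ count Q?
sum-count≤count R? Q? injective R⇒Q = ≤-trans (≤-reflexive (∑-comm (λ i j → 𝟙 (R? i j)))) (sum-mono column)
  where
  column : ∀ j → count (λ i → R? i j) ≤ 𝟙 (Q? j)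
  column j with Q? j
  ... | yes _ = count-unique≤1 (λ i → R? i j) injective
  ... | no ¬q = ≤-reflexive (sum-zero λ i → 𝟙-no (R? i j) (¬q ∘ R⇒Q))

length-filter-tabulate :
  ∀ {n} {A : Set} {P : A → Set} (P? : Decidable P) (f : Fin n → A) →
  length (filter P? (tabulate f)) ≡ count (P? ∘ f)
length-filter-tabulate {zero}  P? f = refl
length-filter-tabulate {suc n} P? f with P? (f zero)
... | yes _ = cong suc (length-filter-tabulate P? (f ∘ suc))
... | no _  = length-filter-tabulate P? (f ∘ suc)

length-filter-cartesianProduct :
  ∀ {m n} {A : Set} {P : A × Fin n → Set} (P? : Decidable P) (f : Fin m → A) →
  length (filter P? (cartesianProduct (tabulate f) (allFin n))) ≡
  sum (λ i → count (λ j → P? (f i , j)))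
length-filter-cartesianProduct {zero}  P? f = refl
length-filter-cartesianProduct {suc m} {n} P? f = begin
  length (filter P? (row ++ rest))
    ≡⟨ cong length (List.filter-++ P? row rest) ⟩
  length (filter P? row ++ filter P? rest)
    ≡⟨ List.length-++ (filter P? row) ⟩
  length (filter P? row) + length (filter P? rest)
    ≡⟨ cong₂ _+_ (trans (cong (length ∘ filter P?) (List.map-tabulate id (f zero ,_)))
                        (length-filter-tabulate P? (f zero ,_)))
                 (length-filter-cartesianProduct P? (f ∘ suc)) ⟩
  count (λ j → P? (f zero , j)) + sum (λ i → count (λ j → P? (f (suc i) , j))) ∎
  where
  open ≡-Reasoning
  row  = map (f zero ,_) (allFin n)
  rest = cartesianProduct (tabulate (f ∘ suc)) (allFin n)

degree≡count : ∀ {n} (G : Graph n) u → degree G u ≡ count (adj? G u)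
degree≡count G u = length-filter-tabulate (adj? G u) id

-- The arithmetic of the approximation factor

2xy≤x²+y² : ∀ x y → 2 * (x * y) ≤ x * x + y * y
2xy≤x²+y² x y with ≤-total x y
... | inj₁ x≤y = subst (λ y → 2 * (x * y) ≤ x * x + y * y) (m+[n∸m]≡n x≤y) (bound x (y ∸ x))
  where
  bound : ∀ x d → 2 * (x * (x + d)) ≤ x * x + (x + d) * (x + d)
  bound x d = m+n≤o⇒m≤o _ (≤-reflexive (identity x d))
    where
    identity : ∀ x d → 2 * (x * (x + d)) + d * d ≡ x * x + (x + d) * (x + d)
    identity = solve-∀
... | inj₂ y≤x = subst (λ x → 2 * (x * y) ≤ x * x + y * y) (m+[n∸m]≡n y≤x) (bound y (x ∸ y))
  where
  bound : ∀ y d → 2 * ((y + d) * y) ≤ (y + d) * (y + d) + y * y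
  bound y d = m+n≤o⇒m≤o _ (≤-reflexive (identity y d))
    where
    identity : ∀ y d → 2 * ((y + d) * y) + d * d ≡ (y + d) * (y + d) + y * y
    identity = solve-∀

-- The factor is γ = (N + E) / N, where 4 N² ≤ 3 E² says γ ≥ 1 + 2/√3.
module Weights (N E k : ℕ) .{{_ : NonZero N}} (N≤E : N ≤ E)
               (4N²≤3E² : 4 * (N * N) ≤ 3 * (E * E)) where

  M : ℕ
  M = N + E

  2N≤M : N + N ≤ M
  2N≤M = +-monoʳ-≤ N N≤E

  -- gain c − loss c is k N times the weight γ x − 1 if x = c/k ≥ 1/2, and
  -- γ x + 1 − γ if x < 1/2.
  gain : ℕ → ℕ
  gain c with k ≤? 2 * c
  ... | yes _ = M * c
  ... | no _  = M * c + N * k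

  loss : ℕ → ℕ
  loss c with k ≤? 2 * c
  ... | yes _ = N * k
  ... | no _  = M * k

  -- Two high ends have nonnegative weight by γ ≥ 2. With one high and one low end the terms `N * k`
  -- match and only `M * k ≤ M * (c + d)` is left. Two low ends would give c + d < k.
  loss≤gain : ∀ c d → k ≤ c + d → loss c + loss d ≤ gain c + gain d
  loss≤gain c d k≤c+d with k ≤? 2 * c | k ≤? 2 * d
  ... | yes _ | yes _ = begin
    N * k + N * k ≡⟨ *-distribʳ-+ k N N ⟨
    (N + N) * k   ≤⟨ *-mono-≤ 2N≤M k≤c+d ⟩
    M * (c + d)   ≡⟨ *-distribˡ-+ M c d ⟩
    M * c + M * d ∎
    where open ≤-Reasoning
  ... | yes _ | no _ = begin
    N * k + M * k           ≤⟨ +-monoʳ-≤ (N * k) (*-monoʳ-≤ M k≤c+d) ⟩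
    N * k + M * (c + d)     ≡⟨ identity N M k c d ⟩
    M * c + (M * d + N * k) ∎
    where
    open ≤-Reasoning
    identity : ∀ N M k c d → N * k + M * (c + d) ≡ M * c + (M * d + N * k)
    identity = solve-∀
  ... | no _ | yes _ = begin
    M * k + N * k         ≤⟨ +-monoˡ-≤ (N * k) (*-monoʳ-≤ M k≤c+d) ⟩
    M * (c + d) + N * k   ≡⟨ identity N M k c d ⟩
    M * c + N * k + M * d ∎
    where
    open ≤-Reasoning
    identity : ∀ N M k c d → M * (c + d) + N * k ≡ M * c + N * k + M * d
    identity = solve-∀
  ... | no 2c≱k | no 2d≱k = ⊥-elim (<⇒≱ (+-mono-< (≰⇒> 2c≱k) (≰⇒> 2d≱k)) (begin
    k + k         ≤⟨ +-mono-≤ k≤c+d k≤c+d ⟩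
    c + d + (c + d) ≡⟨ identity c d ⟩
    2 * c + 2 * d ∎))
    where
    open ≤-Reasoning
    identity : ∀ c d → c + d + (c + d) ≡ 2 * c + 2 * d
    identity = solve-∀

  -- With x = c/k this is 2 - x ≤ γ (1 - x + x²). Multiplying by 4 M completes the square (2 M c - E
  -- k)², and what remains is 4 N² ≤ 3 E².
  quadratic : ∀ c → N * (k * k) + E * (k * c) ≤ E * (k * k) + M * (c * c)
  quadratic c = *-cancelˡ-≤ M (*-cancelˡ-≤ 4 (begin
    4 * (M * (N * (k * k) + E * (k * c)))
      ≡⟨ lhs N E k c ⟩
    4 * (N * N) * (k * k) + 4 * (N * E) * (k * k) + 2 * ((2 * (M * c)) * (E * k))
      ≤⟨ +-mono-≤ (+-monoˡ-≤ _ (*-monoˡ-≤ (k * k) 4N²≤3E²)) (2xy≤x²+y² (2 * (M * c)) (E * k)) ⟩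
    3 * (E * E) * (k * k) + 4 * (N * E) * (k * k)
      + ((2 * (M * c)) * (2 * (M * c)) + (E * k) * (E * k))
      ≡⟨ rhs N E k c ⟩
    4 * (M * (E * (k * k) + M * (c * c))) ∎))
    where
    open ≤-Reasoning
    instance
      M≢0 : NonZero M
      M≢0 = >-nonZero (≤-trans (>-nonZero⁻¹ N) (m≤m+n N E))
    lhs : ∀ N E k c → 4 * ((N + E) * (N * (k * k) + E * (k * c))) ≡
          4 * (N * N) * (k * k) + 4 * (N * E) * (k * k) + 2 * ((2 * ((N + E) * c)) * (E * k))
    lhs = solve-∀
    rhs : ∀ N E k c → 3 * (E * E) * (k * k) + 4 * (N * E) * (k * k)
          + ((2 * ((N + E) * c)) * (2 * ((N + E) * c)) + (E * k) * (E * k)) ≡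
          4 * ((N + E) * (E * (k * k) + (N + E) * (c * c)))
    rhs = solve-∀

  -- Collecting terms leaves N k p + q D ≤ M k c with D = 2 N k + M c - M k. The split is on the
  -- sign of D; for D ≤ 0 the q term only helps, and p ≤ c with N ≤ M suffices.
  low-vertex : ∀ c p q → 2 * c ≤ k → p ≤ c → p + q ≤ k →
               N * k * (p + q) + q * (M * c + N * k) ≤ M * k * c + q * (M * k)
  low-vertex c p q 2c≤k p≤c p+q≤k with ≤-total (2 * (N * k) + M * c) (M * k)
  ... | inj₁ D≤0 = begin
    N * k * (p + q) + q * (M * c + N * k)     ≡⟨ identity N M k p q c ⟩
    N * k * p + q * (2 * (N * k) + M * c)     ≤⟨ +-mono-≤ (*-mono-≤ (*-monoˡ-≤ k (m≤m+n N E)) p≤c) (*-monoʳ-≤ q D≤0) ⟩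
    M * k * c + q * (M * k)                   ∎
    where
    open ≤-Reasoning
    identity : ∀ N M k p q c → N * k * (p + q) + q * (M * c + N * k) ≡
               N * k * p + q * (2 * (N * k) + M * c)
    identity = solve-∀
  -- For D ≥ 0 the left side is largest at p = c and q = k ∸ c, where the
  -- inequality is the quadratic one.
  ... | inj₂ D≥0 = begin
    N * k * (p + q) + q * (M * c + N * k)     ≡⟨ identity N M k p q c ⟩
    N * k * p + q * (2 * (N * k) + M * c)     ≡⟨ cong (λ x → N * k * p + q * x) Mk+D ⟨
    N * k * p + q * (M * k + D)               ≡⟨ identity₂ (N * k) p q (M * k) D ⟩
    q * (M * k) + (N * k * p + q * D)         ≤⟨ +-monoʳ-≤ (q * (M * k)) (+-cancelʳ-≤ (D * c) _ _ main) ⟩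
    q * (M * k) + M * k * c                   ≡⟨ +-comm (q * (M * k)) _ ⟩
    M * k * c + q * (M * k)                   ∎
    where
    open ≤-Reasoning
    D = (2 * (N * k) + M * c) ∸ M * k
    Mk+D : M * k + D ≡ 2 * (N * k) + M * c
    Mk+D = m+[n∸m]≡n D≥0
    identity : ∀ N M k p q c → N * k * (p + q) + q * (M * c + N * k) ≡
               N * k * p + q * (2 * (N * k) + M * c)
    identity = solve-∀
    identity₂ : ∀ n p q m D → n * p + q * (m + D) ≡ q * m + (n * p + q * D)
    identity₂ = solve-∀
    -- The coefficient of q is at most that of p, so under p + q ≤ k it never hurts to exchange a
    -- unit of q for a unit of p until p = c. This is where 2 c ≤ k is used.
    D≤Nk : D ≤ N * k
    D≤Nk = m≤n+o⇒m∸n≤o _ (M * k) (*-cancelˡ-≤ 2 (begin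
      2 * (2 * (N * k) + M * c)               ≡⟨ i₁ N M k c ⟩
      (N + N) * k + 2 * (N * k) + M * (2 * c) ≤⟨ +-mono-≤ (+-monoˡ-≤ _ (*-monoˡ-≤ k 2N≤M)) (*-monoʳ-≤ M 2c≤k) ⟩
      M * k + 2 * (N * k) + M * k             ≡⟨ i₂ N M k ⟩
      2 * (M * k + N * k)                     ∎))
      where
      i₁ : ∀ N M k c → 2 * (2 * (N * k) + M * c) ≡ (N + N) * k + 2 * (N * k) + M * (2 * c)
      i₁ = solve-∀
      i₂ : ∀ N M k → M * k + 2 * (N * k) + M * k ≡ 2 * (M * k + N * k)
      i₂ = solve-∀
    -- The case p = c, q = k - c, with `D * c` moved to the right to avoid a truncated subtraction.
    -- The summand `M * k * k` added to both sides completes `M * k + D`, so that `Mk+D` can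
    -- eliminate D.
    extreme : D * k + N * k * c ≤ M * k * c + D * c
    extreme = +-cancelʳ-≤ (M * k * k + E * (k * c)) _ _ (begin
      D * k + N * k * c + (M * k * k + E * (k * c))  ≡⟨ i₁ N E k c D ⟩
      (M * k + D) * k + N * k * c + E * (k * c)      ≡⟨ cong (λ x → x * k + N * k * c + E * (k * c)) Mk+D ⟩
      (2 * (N * k) + M * c) * k + N * k * c + E * (k * c)
        ≡⟨ i₂ N E k c ⟩
      N * (k * k) + E * (k * c) + (N * (k * k) + M * c * k + N * k * c)
        ≤⟨ +-monoˡ-≤ _ (quadratic c) ⟩
      E * (k * k) + M * (c * c) + (N * (k * k) + M * c * k + N * k * c)
        ≡⟨ i₃ N E k c ⟩
      (2 * (N * k) + M * c) * c + M * k * k + E * (k * c)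
        ≡⟨ cong (λ x → x * c + M * k * k + E * (k * c)) Mk+D ⟨
      (M * k + D) * c + M * k * k + E * (k * c)      ≡⟨ i₄ (M * k) c D (M * k * k) (E * (k * c)) ⟩
      M * k * c + D * c + (M * k * k + E * (k * c))  ∎)
      where
      i₁ : ∀ N E k c D → D * k + N * k * c + ((N + E) * k * k + E * (k * c)) ≡
           ((N + E) * k + D) * k + N * k * c + E * (k * c)
      i₁ = solve-∀
      i₂ : ∀ N E k c → (2 * (N * k) + (N + E) * c) * k + N * k * c + E * (k * c) ≡
           N * (k * k) + E * (k * c) + (N * (k * k) + (N + E) * c * k + N * k * c)
      i₂ = solve-∀
      i₃ : ∀ N E k c → E * (k * k) + (N + E) * (c * c) + (N * (k * k) + (N + E) * c * k + N * k * c) ≡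
           (2 * (N * k) + (N + E) * c) * c + (N + E) * k * k + E * (k * c)
      i₃ = solve-∀
      i₄ : ∀ m c D x y → (m + D) * c + x + y ≡ m * c + D * c + (x + y)
      i₄ = solve-∀
    main : N * k * p + q * D + D * c ≤ M * k * c + D * c
    main = ≤-trans (subst (λ c → N * k * p + q * D + D * c ≤ D * k + N * k * c) (m+[n∸m]≡n p≤c) (begin
      N * k * p + q * D + D * (p + α)             ≡⟨ i₁ (N * k) p q D α ⟩
      D * (p + q) + N * k * p + D * α             ≤⟨ +-mono-≤ (+-monoˡ-≤ _ (*-monoʳ-≤ D p+q≤k)) (*-monoˡ-≤ α D≤Nk) ⟩
      D * k + N * k * p + N * k * α               ≡⟨ i₂ (N * k) p α (D * k) ⟩
      D * k + N * k * (p + α)                     ∎)) extreme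
      where
      α = c ∸ p
      i₁ : ∀ n p q D α → n * p + q * D + D * (p + α) ≡ D * (p + q) + n * p + D * α
      i₁ = solve-∀
      i₂ : ∀ n p α x → x + n * p + n * α ≡ x + n * (p + α)
      i₂ = solve-∀

  vertex : ∀ c p q → p ≤ c → p + q ≤ k →
           N * k * (p + q) + q * gain c ≤ M * k * c + q * loss c
  vertex c p q p≤c p+q≤k with k ≤? 2 * c
  ... | no 2c≱k = low-vertex c p q (<⇒≤ (≰⇒> 2c≱k)) p≤c p+q≤k
  -- At a high vertex M c ≥ N k, so p may be given the same coefficient M c as q; then p + q ≤ k
  -- finishes.
  ... | yes k≤2c = begin
    N * k * (p + q) + q * (M * c)            ≡⟨ i₁ (N * k) p q (M * c) ⟩
    N * k * p + q * (M * c) + q * (N * k)    ≤⟨ +-monoˡ-≤ _ (+-monoˡ-≤ _ (*-monoˡ-≤ p Nk≤Mc)) ⟩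
    M * c * p + q * (M * c) + q * (N * k)    ≡⟨ cong (_+ q * (N * k)) (i₂ (M * c) p q) ⟩
    M * c * (p + q) + q * (N * k)            ≤⟨ +-monoˡ-≤ _ (*-monoʳ-≤ (M * c) p+q≤k) ⟩
    M * c * k + q * (N * k)                  ≡⟨ cong (_+ q * (N * k)) (i₃ M c k) ⟩
    M * k * c + q * (N * k)                  ∎
    where
    open ≤-Reasoning
    i₁ : ∀ n p q m → n * (p + q) + q * m ≡ n * p + q * m + q * n
    i₁ = solve-∀
    i₂ : ∀ m p q → m * p + q * m ≡ m * (p + q)
    i₂ = solve-∀
    i₃ : ∀ m c k → m * c * k ≡ m * k * c
    i₃ = solve-∀
    Nk≤Mc : N * k ≤ M * c
    Nk≤Mc = begin
      N * k       ≤⟨ *-monoʳ-≤ N k≤2c ⟩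
      N * (2 * c) ≡⟨ i₄ N c ⟩
      (N + N) * c ≤⟨ *-monoˡ-≤ c 2N≤M ⟩
      M * c       ∎
      where
      i₄ : ∀ N c → N * (2 * c) ≡ (N + N) * c
      i₄ = solve-∀

-- Coloured degrees

Proper : ∀ {k n} → Table k n → Set
Proper f = ∀ {u v w c} → f u v ≡ just c → f u w ≡ just c → v ≡ w

Maximal : ∀ {k n} → Graph n → Table k n → Set
Maximal G f = ∀ {u v} → Adj G u v → f u v ≡ nothing → ∀ c → ¬ (Free f c u × Free f c v)

module _ {k n} (f : Table k n) where

  Colored : Fin n → Fin n → Set
  Colored u v = T (is-just (f u v))

  colored? : ∀ u v → Dec (Colored u v)
  colored? u v = T? (is-just (f u v))

  has? : ∀ u c v → Dec (f u v ≡ just c)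
  has? u c v = ≡-dec Fin._≟_ (f u v) (just c)

  coloredDegree : Fin n → ℕ
  coloredDegree u = count (colored? u)

  just⇒Colored : ∀ {u v c} → f u v ≡ just c → Colored u v
  just⇒Colored eq = subst (T ∘ is-just) (sym eq) tt

  Colored⇒just : ∀ {u v} → Colored u v → ∃[ c ] f u v ≡ just c
  Colored⇒just {u} {v} t with f u v
  ... | just c = c , refl

  ¬Colored⇒nothing : ∀ {u v} → ¬ Colored u v → f u v ≡ nothing
  ¬Colored⇒nothing {u} {v} ¬t with f u v
  ... | just _  = ⊥-elim (¬t tt)
  ... | nothing = refl

  nothing⇒¬Colored : ∀ {u v} → f u v ≡ nothing → ¬ Colored u v
  nothing⇒¬Colored eq = subst (T ∘ is-just) eq

  free-or-used : ∀ c u → Free f c u ⊎ 1 ≤ count (has? u c)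
  free-or-used c u with Fin.any? (has? u c)
  ... | yes (v , eq) = inj₂ (1≤count (has? u c) eq)
  ... | no unused    = inj₁ λ v eq → unused (v , eq)

  module _ (proper : Proper f) where

    coloredDegree≤k : ∀ u → coloredDegree u ≤ k
    coloredDegree≤k u = begin
      coloredDegree u                         ≤⟨ sum-mono colored⇒color ⟩
      sum (λ v → count (λ c → has? u c v))    ≤⟨ sum-count≤count (λ v c → has? u c v) (λ _ → yes tt) proper (λ _ → tt) ⟩
      sum {k} (λ _ → 1)                       ≡⟨ sum-ones k ⟩
      k                                       ∎
      where
      open ≤-Reasoning
      colored⇒color : ∀ v → 𝟙 (colored? u v) ≤ count (λ c → has? u c v)
      colored⇒color v = 𝟙≤ (colored? u v) λ t →
        1≤count (λ c → has? u c v) (proj₂ (Colored⇒just t))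

    -- Each blocked colour occurs at u or v, and an edge has only one colour, so distinct colours at
    -- a vertex need distinct edges. The statement concerns the first j colours because it serves
    -- twice: j = k gives the degree condition at an uncoloured edge, and smaller j bound the scan
    -- for a free colour.
    blocked≤degrees :
      ∀ {u v j} (j≤k : j ≤ k) →
      (∀ i → ¬ (Free f (inject≤ i j≤k) u × Free f (inject≤ i j≤k) v)) →
      j ≤ coloredDegree u + coloredDegree v
    blocked≤degrees {u} {v} {j} j≤k blocked = begin
      j                                    ≡⟨ sum-ones j ⟨
      sum {j} (λ _ → 1)                    ≤⟨ sum-mono used ⟩
      sum (λ i → occurs u i + occurs v i)  ≡⟨ ∑-distrib-+ (occurs u) (occurs v) ⟩
      sum (occurs u) + sum (occurs v)      ≤⟨ +-mono-≤ (bound u) (bound v) ⟩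
      coloredDegree u + coloredDegree v    ∎
      where
      open ≤-Reasoning
      color-of : Fin j → Fin k
      color-of i = inject≤ i j≤k
      occurs : Fin n → Fin j → ℕ
      occurs x i = count (has? x (color-of i))
      used : ∀ i → 1 ≤ occurs u i + occurs v i
      used i with free-or-used (color-of i) u | free-or-used (color-of i) v
      ... | inj₁ free-u | inj₁ free-v = ⊥-elim (blocked i (free-u , free-v))
      ... | inj₂ used-u | _           = ≤-trans used-u (m≤m+n _ _)
      ... | _           | inj₂ used-v = ≤-trans used-v (m≤n+m _ _)
      bound : ∀ x → sum (occurs x) ≤ coloredDegree x
      bound x = sum-count≤count (λ i → has? x (color-of i)) (colored? x)
        (λ p q → Fin.inject≤-injective j≤k j≤k _ _ (just-injective (trans (sym p) q))) just⇒Colored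

nothing≢just : ∀ {A : Set} {m : Maybe A} {x} → m ≡ nothing → m ≢ just x
nothing≢just refl ()

color-proper : ∀ {k n} {G : Graph n} (f : EdgeColoring k G) → Proper (color f)
color-proper {G = G} f {u} {v} {w} p q with v Fin.≟ w
... | yes v≡w = v≡w
... | no v≢w with adj? G u v | adj? G u w
...   | no ¬a | _     = ⊥-elim (nothing≢just (off-edges f u v ¬a) p)
...   | yes _ | no ¬a = ⊥-elim (nothing≢just (off-edges f u w ¬a) q)
...   | yes a | yes b with proper f u v w a b v≢w
...     | inj₁ differ = ⊥-elim (differ (trans p (sym q)))
...     | inj₂ (none , _) with trans (sym none) p
...       | ()

-- The handshake identity: a coloured pair is increasing in exactly one of its two orders, and the
-- diagonal carries no colour since the graph has no loops.
2#colored≡degrees : ∀ {k n} {G : Graph n} (f : EdgeColoring k G) →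
                    2 * #colored f ≡ sum (coloredDegree (color f))
2#colored≡degrees {n = n} {G} f = begin
  2 * #colored f                                    ≡⟨ cong (2 *_) (length-filter-cartesianProduct P? id) ⟩
  2 * ∑∑ up                                         ≡⟨ cong (∑∑ up +_) (+-identityʳ _) ⟩
  ∑∑ up + ∑∑ up                                     ≡⟨ cong (∑∑ up +_) (∑-comm up) ⟩
  ∑∑ up + ∑∑ (λ u v → up v u)                       ≡⟨ ∑-distrib-+ (sum ∘ up) _ ⟨
  sum (λ u → sum (up u) + sum (λ v → up v u))       ≡⟨ sum-cong-≗ (λ u → sym (∑-distrib-+ (up u) (λ v → up v u))) ⟩
  ∑∑ (λ u v → up u v + up v u)                      ≡⟨ sum-cong-≗ (λ u → sum-cong-≗ (split u)) ⟩
  sum (coloredDegree (color f))                     ∎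
  where
  open ≡-Reasoning
  P? : ∀ e → Dec (proj₁ e F.< proj₂ e × Colored (color f) (proj₁ e) (proj₂ e))
  P? (u , v) = (u Fin.<? v) ×-dec colored? (color f) u v
  up : Fin n → Fin n → ℕ
  up u v = 𝟙 (P? (u , v))
  ∑∑ : (Fin n → Fin n → ℕ) → ℕ
  ∑∑ e = sum (λ u → sum (e u))
  flip-colored : ∀ {u v} → Colored (color f) u v → Colored (color f) v u
  flip-colored {u} {v} = subst (T ∘ is-just) (color-sym f u v)
  split : ∀ u v → up u v + up v u ≡ 𝟙 (colored? (color f) u v)
  split u v with colored? (color f) u v
  ... | no ¬t = trans (cong₂ _+_ (𝟙-no (P? (u , v)) (¬t ∘ proj₂)) (𝟙-no (P? (v , u)) (¬t ∘ flip-colored ∘ proj₂)))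
                      (sym (𝟙-no (colored? (color f) u v) ¬t))
  ... | yes t = trans once (sym (𝟙-yes (colored? (color f) u v) t))
    where
    once : up u v + up v u ≡ 1
    once with Fin.<-cmp u v
    ... | tri< u<v _ v≮u = cong₂ _+_ (𝟙-yes (P? (u , v)) (u<v , t)) (𝟙-no (P? (v , u)) (v≮u ∘ proj₁))
    ... | tri> u≮v _ v<u = cong₂ _+_ (𝟙-no (P? (u , v)) (u≮v ∘ proj₁)) (𝟙-yes (P? (v , u)) (v<u , flip-colored t))
    ... | tri≈ _ refl _  = ⊥-elim (nothing⇒¬Colored (color f) (off-edges f u u (irrefl G)) t)

-- Maximal colourings are approximations

-- This passes from vertex weights to edge weights. Ordered pairs meet every edge twice, whence the
-- two copies on the left; exchanging the summations in one of them gives the weight of the other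
-- end.
∑-symmetric : ∀ {n} (e : Fin n → Fin n → ℕ) → (∀ u v → e u v ≡ e v u) → (h : Fin n → ℕ) →
              sum (λ u → sum (e u) * h u) + sum (λ u → sum (e u) * h u) ≡
              sum (λ u → sum (λ v → e u v * (h u + h v)))
∑-symmetric e e-sym h = begin
  sum (λ u → sum (e u) * h u) + sum (λ u → sum (e u) * h u)
    ≡⟨ cong₂ _+_ expand (trans expand (∑-comm (λ u v → e u v * h u))) ⟩
  sum (λ u → sum (λ v → e u v * h u)) + sum (λ v → sum (λ u → e u v * h u))
    ≡⟨ ∑-distrib-+ (λ u → sum (λ v → e u v * h u)) (λ u → sum (λ v → e v u * h v)) ⟨
  sum (λ u → sum (λ v → e u v * h u) + sum (λ v → e v u * h v))
    ≡⟨ sum-cong-≗ (λ u → trans (sym (∑-distrib-+ (λ v → e u v * h u) (λ v → e v u * h v))) (sum-cong-≗ (merge u))) ⟩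
  sum (λ u → sum (λ v → e u v * (h u + h v))) ∎
  where
  open ≡-Reasoning
  expand : sum (λ u → sum (e u) * h u) ≡ sum (λ u → sum (λ v → e u v * h u))
  expand = sum-cong-≗ (λ u → *-distribʳ-sum (h u) (e u))
  merge : ∀ u v → e u v * h u + e v u * h v ≡ e u v * (h u + h v)
  merge u v = trans (cong (λ x → e u v * h u + x * h v) (e-sym v u)) (sym (*-distribˡ-+ (e u v) (h u) (h v)))

module Ratio (N E : ℕ) .{{_ : NonZero N}} (N≤E : N ≤ E) (4N²≤3E² : 4 * (N * N) ≤ 3 * (E * E))
             {k n} .{{_ : NonZero k}} {G : Graph n}
             (f : EdgeColoring k G) (f-maximal : Maximal G (color f)) (g : EdgeColoring k G) where

  open Weights N E k N≤E 4N²≤3E²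

  both? only-g? : ∀ u v → Dec _
  both?   u v = colored? (color g) u v ×-dec colored? (color f) u v
  only-g? u v = colored? (color g) u v ×-dec ¬? (colored? (color f) u v)

  c p q : Fin n → ℕ
  c = coloredDegree (color f)
  p u = count (both? u)
  q u = count (only-g? u)

  p≤c : ∀ u → p u ≤ c u
  p≤c u = sum-mono λ v → 𝟙-mono (both? u v) (colored? (color f) u v) proj₂

  p+q≡degree : ∀ u → p u + q u ≡ coloredDegree (color g) u
  p+q≡degree u = trans (sym (∑-distrib-+ (𝟙 ∘ both? u) (𝟙 ∘ only-g? u))) (sum-cong-≗ split)
    where
    split : ∀ v → 𝟙 (both? u v) + 𝟙 (only-g? u v) ≡ 𝟙 (colored? (color g) u v)
    split v with is-just (color g u v) | is-just (color f u v)
    ... | false | _     = refl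
    ... | true  | false = refl
    ... | true  | true  = refl

  q-weights : sum (λ u → q u * loss (c u)) ≤ sum (λ u → q u * gain (c u))
  q-weights = *-cancelˡ-≤ 2 (begin
    2 * sum (λ u → q u * loss (c u))                                    ≡⟨ double (loss ∘ c) ⟩
    sum (λ u → sum (λ v → e u v * (loss (c u) + loss (c v))))           ≤⟨ sum-mono (λ u → sum-mono (edge u)) ⟩
    sum (λ u → sum (λ v → e u v * (gain (c u) + gain (c v))))           ≡⟨ double (gain ∘ c) ⟨
    2 * sum (λ u → q u * gain (c u))                                    ∎)
    where
    open ≤-Reasoning
    e : Fin n → Fin n → ℕ
    e u v = 𝟙 (only-g? u v)
    e-sym : ∀ u v → e u v ≡ e v u
    e-sym u v rewrite color-sym g u v | color-sym f u v = refl
    double : ∀ h → 2 * sum (λ u → q u * h u) ≡ sum (λ u → sum (λ v → e u v * (h u + h v)))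
    double h = trans (cong (sum (λ u → q u * h u) +_) (+-identityʳ _)) (∑-symmetric e e-sym h)
    edge : ∀ u v → e u v * (loss (c u) + loss (c v)) ≤ e u v * (gain (c u) + gain (c v))
    -- An edge coloured only by `g` is uncoloured in the maximal `f`, so all k colours are blocked
    -- there.
    edge u v = 𝟙*-mono (only-g? u v) λ (in-g , ¬in-f) → loss≤gain (c u) (c v)
      (blocked≤degrees (color f) (color-proper f) ≤-refl λ i →
        f-maximal (adjacent in-g) (¬Colored⇒nothing (color f) ¬in-f) (inject≤ i ≤-refl))
      where
      adjacent : Colored (color g) u v → Adj G u v
      adjacent in-g = decidable-stable (adj? G u v) λ ¬a → nothing⇒¬Colored (color g) (off-edges g u v ¬a) in-g

  degrees-ratio : N * sum (coloredDegree (color g)) ≤ M * sum c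
  degrees-ratio = *-cancelˡ-≤ k (begin
    k * (N * sum (coloredDegree (color g)))     ≡⟨ rearrange k N _ ⟩
    -- The vertex bounds leave gains on the left and losses on the right; `q-weights` replaces the
    -- losses by gains, which then cancel.
    N * k * sum (coloredDegree (color g))       ≤⟨ +-cancelʳ-≤ (sum (λ u → q u * gain (c u))) _ _ weighted ⟩
    M * k * sum c                               ≡⟨ rearrange k M _ ⟨
    k * (M * sum c)                             ∎)
    where
    open ≤-Reasoning
    rearrange : ∀ k N x → k * (N * x) ≡ N * k * x
    rearrange = solve-∀
    weighted : N * k * sum (coloredDegree (color g)) + sum (λ u → q u * gain (c u)) ≤
               M * k * sum c + sum (λ u → q u * gain (c u))
    weighted = begin
      N * k * sum (coloredDegree (color g)) + sum (λ u → q u * gain (c u))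
        ≡⟨ cong (_+ sum gains) (*-distribˡ-sum (N * k) (coloredDegree (color g))) ⟩
      sum (λ u → N * k * coloredDegree (color g) u) + sum (λ u → q u * gain (c u))
        ≡⟨ ∑-distrib-+ (λ u → N * k * coloredDegree (color g) u) gains ⟨
      sum (λ u → N * k * coloredDegree (color g) u + q u * gain (c u))
        ≤⟨ sum-mono vertex-bound ⟩
      sum (λ u → M * k * c u + q u * loss (c u))
        ≡⟨ ∑-distrib-+ (λ u → M * k * c u) losses ⟩
      sum (λ u → M * k * c u) + sum (λ u → q u * loss (c u))
        ≡⟨ cong (_+ sum losses) (*-distribˡ-sum (M * k) c) ⟨
      M * k * sum c + sum (λ u → q u * loss (c u))
        ≤⟨ +-monoʳ-≤ _ q-weights ⟩
      M * k * sum c + sum (λ u → q u * gain (c u)) ∎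
      where
      gains losses : Fin n → ℕ
      gains u  = q u * gain (c u)
      losses u = q u * loss (c u)
      vertex-bound : ∀ u → N * k * coloredDegree (color g) u + q u * gain (c u) ≤
                     M * k * c u + q u * loss (c u)
      vertex-bound u = subst (λ d → N * k * d + q u * gain (c u) ≤ M * k * c u + q u * loss (c u))
        (p+q≡degree u)
        (vertex (c u) (p u) (q u) (p≤c u)
          (≤-trans (≤-reflexive (p+q≡degree u)) (coloredDegree≤k (color g) (color-proper g) u)))

  ratio : N * #colored g ≤ M * #colored f
  ratio = *-cancelˡ-≤ 2 (begin
    2 * (N * #colored g)                  ≡⟨ rearrange N _ ⟩
    N * (2 * #colored g)                  ≡⟨ cong (N *_) (2#colored≡degrees g) ⟩
    N * sum (coloredDegree (color g))     ≤⟨ degrees-ratio ⟩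
    M * sum c                             ≡⟨ cong (M *_) (2#colored≡degrees f) ⟨
    M * (2 * #colored f)                  ≡⟨ rearrange M _ ⟨
    2 * (M * #colored f)                  ∎)
    where
    open ≤-Reasoning
    rearrange : ∀ N x → 2 * (N * x) ≡ N * (2 * x)
    rearrange = solve-∀

-- From natural numbers to the rationals above the factor

3<r²⇒3B²<A² : ∀ A B → mkℚᵘ (ℤ.+ 3) 0 ℚᵘ.< mkℚᵘ (ℤ.+ A) B ℚᵘ.* mkℚᵘ (ℤ.+ A) B →
              3 * (suc B * suc B) < A * A
3<r²⇒3B²<A² A B (ℚᵘ.*<* 3<r²) = ℤₚ.drop‿+<+ (subst₂ ℤ._<_ (sym (ℤₚ.pos-* 3 (suc B * suc B)))
  (trans (ℤₚ.*-identityʳ (ℤ.+ A ℤ.* ℤ.+ A)) (sym (ℤₚ.pos-* A A))) 3<r²)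

-- The rational `mkℚᵘ (ℤ.+ A) B` is A / (B + 1), so with N = 3 (B + 1) and E = 2 A the factor 1 +
-- 2r/3 is exactly (N + E) / N.
Nb≤[N+E]a⇒b≤qa :
  ∀ A B a b → (suc B * 3) * b ≤ (suc B * 3 + 2 * A) * a →
  mkℚᵘ (ℤ.+ b) 0 ℚᵘ.≤
  (mkℚᵘ (ℤ.+ 1) 0 ℚᵘ.+ mkℚᵘ (ℤ.+ 2) 0 ℚᵘ.* (mkℚᵘ (ℤ.+ A) B ℚᵘ.* mkℚᵘ (ℤ.+ 1) 2)) ℚᵘ.* mkℚᵘ (ℤ.+ a) 0
Nb≤[N+E]a⇒b≤qa A B a b bound = ℚᵘ.*≤* (subst₂ ℤ._≤_ lhs rhs (ℤ.+≤+ bound))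
  where
  open ≡-Reasoning
  -- The denominator in the shape in which unnormalised arithmetic produces it.
  D = 1 * (1 * (suc B * 3)) * 1
  D≡N : D ≡ suc B * 3
  D≡N = identity (suc B * 3)
    where
    identity : ∀ x → 1 * (1 * x) * 1 ≡ x
    identity = solve-∀
  lhs : ℤ.+ ((suc B * 3) * b) ≡ ℤ.+ b ℤ.* ℤ.+ D
  lhs = trans (cong ℤ.+_ (trans (*-comm (suc B * 3) b) (cong (b *_) (sym D≡N)))) (ℤₚ.pos-* b D)
  rhs : ℤ.+ ((suc B * 3 + 2 * A) * a) ≡
        (ℤ.+ 1 ℤ.* ℤ.+ (1 * (suc B * 3)) ℤ.+ ℤ.+ 2 ℤ.* (ℤ.+ A ℤ.* ℤ.+ 1) ℤ.* ℤ.+ 1) ℤ.* ℤ.+ a ℤ.* ℤ.+ 1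
  rhs = begin
    ℤ.+ ((suc B * 3 + 2 * A) * a)                                     ≡⟨ ℤₚ.pos-* (suc B * 3 + 2 * A) a ⟩
    (ℤ.+ (suc B * 3) ℤ.+ ℤ.+ (2 * A)) ℤ.* ℤ.+ a                      ≡⟨ cong₂ (λ x y → (x ℤ.+ y) ℤ.* ℤ.+ a) left right ⟩
    (ℤ.+ 1 ℤ.* ℤ.+ (1 * (suc B * 3)) ℤ.+ ℤ.+ 2 ℤ.* (ℤ.+ A ℤ.* ℤ.+ 1) ℤ.* ℤ.+ 1) ℤ.* ℤ.+ a
                                                                      ≡⟨ ℤₚ.*-identityʳ _ ⟨
    (ℤ.+ 1 ℤ.* ℤ.+ (1 * (suc B * 3)) ℤ.+ ℤ.+ 2 ℤ.* (ℤ.+ A ℤ.* ℤ.+ 1) ℤ.* ℤ.+ 1) ℤ.* ℤ.+ a ℤ.* ℤ.+ 1 ∎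
    where
    left : ℤ.+ (suc B * 3) ≡ ℤ.+ 1 ℤ.* ℤ.+ (1 * (suc B * 3))
    left = trans (cong ℤ.+_ (sym (*-identityˡ (suc B * 3)))) (sym (ℤₚ.*-identityˡ _))
    right : ℤ.+ (2 * A) ≡ ℤ.+ 2 ℤ.* (ℤ.+ A ℤ.* ℤ.+ 1) ℤ.* ℤ.+ 1
    right = trans (ℤₚ.pos-* 2 A)
      (trans (cong (ℤ.+ 2 ℤ.*_) (sym (ℤₚ.*-identityʳ (ℤ.+ A)))) (sym (ℤₚ.*-identityʳ _)))

maximal⇒approximation : ∀ {k n} .{{_ : NonZero k}} {G : Graph n} (f : EdgeColoring k G) →
                        Maximal G (color f) → IsApproximation 1+2√3/3 f
maximal⇒approximation f f-maximal g _ _ (mkℚ -[1+ _ ] _ _ , (ℚ.*<* () , _) , _)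
maximal⇒approximation f f-maximal g _ _ (r@(mkℚ (ℤ.+ A) B _) , (_ , 3<r²) , refl) =
  ℚₚ.toℚᵘ-cancel-≤ (begin
    ℚ.toℚᵘ (ℤ.+ b ℚ./ 1)
      ≃⟨ integral b ⟩
    mkℚᵘ (ℤ.+ b) 0
      ≤⟨ Nb≤[N+E]a⇒b≤qa A B a b (Ratio.ratio N E N≤E 4N²≤3E² f f-maximal g) ⟩
    γᵘ ℚᵘ.* mkℚᵘ (ℤ.+ a) 0
      ≃⟨ ℚᵘₚ.*-cong homo (integral a) ⟨
    ℚ.toℚᵘ γ ℚᵘ.* ℚ.toℚᵘ (ℤ.+ a ℚ./ 1)
      ≃⟨ ℚₚ.toℚᵘ-homo-* γ (ℤ.+ a ℚ./ 1) ⟨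
    ℚ.toℚᵘ (γ ℚ.* (ℤ.+ a ℚ./ 1)) ∎)
  where
  open ℚᵘₚ.≤-Reasoning
  a = #colored f
  b = #colored g
  N = suc B * 3
  E = 2 * A
  γ : ℚ
  γ = ℚ.1ℚ ℚ.+ (ℤ.+ 2 ℚ./ 1) ℚ.* (r ℚ.* (ℤ.+ 1 ℚ./ 3))
  γᵘ : ℚᵘ
  γᵘ = mkℚᵘ (ℤ.+ 1) 0 ℚᵘ.+ mkℚᵘ (ℤ.+ 2) 0 ℚᵘ.* (mkℚᵘ (ℤ.+ A) B ℚᵘ.* mkℚᵘ (ℤ.+ 1) 2)
  integral : ∀ m → ℚ.toℚᵘ (ℤ.+ m ℚ./ 1) ℚᵘ.≃ mkℚᵘ (ℤ.+ m) 0
  integral m = ℚₚ.toℚᵘ-fromℚᵘ (mkℚᵘ (ℤ.+ m) 0)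
  homo : ℚ.toℚᵘ γ ℚᵘ.≃ γᵘ
  homo = ℚᵘₚ.≃-trans (ℚₚ.toℚᵘ-homo-+ ℚ.1ℚ ((ℤ.+ 2 ℚ./ 1) ℚ.* (r ℚ.* (ℤ.+ 1 ℚ./ 3))))
    (ℚᵘₚ.+-congʳ (mkℚᵘ (ℤ.+ 1) 0) (ℚᵘₚ.≃-trans (ℚₚ.toℚᵘ-homo-* (ℤ.+ 2 ℚ./ 1) (r ℚ.* (ℤ.+ 1 ℚ./ 3)))
      (ℚᵘₚ.*-congˡ {mkℚᵘ (ℤ.+ 2) 0} (ℚₚ.toℚᵘ-homo-* r (ℤ.+ 1 ℚ./ 3)))))
  3B²<A² : 3 * (suc B * suc B) < A * A
  3B²<A² = 3<r²⇒3B²<A² A B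
    (ℚᵘₚ.<-respʳ-≃ (ℚₚ.toℚᵘ-homo-* r r) (ℚₚ.toℚᵘ-mono-< 3<r²))
  4N²≤3E² : 4 * (N * N) ≤ 3 * (E * E)
  -- The factor 12 is what turns 3 (B + 1)² into 4 N² and A² into 3 E² at once.
  4N²≤3E² = subst₂ _≤_ (l (suc B)) (ʳ A) (*-monoʳ-≤ 12 (<⇒≤ 3B²<A²))
    where
    l : ∀ B → 12 * (3 * (B * B)) ≡ 4 * ((B * 3) * (B * 3))
    l = solve-∀
    ʳ : ∀ A → 12 * (A * A) ≡ 3 * ((2 * A) * (2 * A))
    ʳ = solve-∀
  -- From 4 N² ≤ 3 E² ≤ 4 E².
  N≤E : N ≤ E
  N≤E = ≮⇒≥ λ E<N → <⇒≱ (*-mono-< E<N E<N) (*-cancelˡ-≤ 4 (≤-trans 4N²≤3E² (*-monoˡ-≤ (E * E) (n≤1+n 3))))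

-- Greedy steps preserve maximality

-- A predicate on bare tables, so that one table can be valid for successive graphs. Properness
-- takes the form that a colour at a vertex determines the other end, which is what the counting
-- arguments use.
record Valid {k n} (G : Graph n) (f : Table k n) : Set where
  field
    table-sym    : ∀ u v → f u v ≡ f v u
    table-off    : ∀ u v → ¬ Adj G u v → f u v ≡ nothing
    table-proper : Proper f

open Valid

toColoring : ∀ {k n} {G : Graph n} {f : Table k n} → Valid G f → EdgeColoring k G
toColoring {f = f} valid .color = f
toColoring valid .color-sym = table-sym valid
toColoring valid .off-edges = table-off valid
toColoring {f = f} valid .proper u v w _ _ v≢w with f u v in uv | f u w in uw
... | just c  | _       = inj₁ λ c≡ → v≢w (table-proper valid uv (trans uw (sym c≡)))
... | nothing | just _  = inj₁ λ ()
... | nothing | nothing = inj₂ (refl , refl)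

other-end : ∀ {n} {u v x y z : Fin n} → SameEdge u v x y → SameEdge u v x z → y ≡ z
other-end (inj₁ (_ , refl)) (inj₁ (_ , refl)) = refl
other-end (inj₁ (refl , refl)) (inj₂ (refl , refl)) = refl
other-end (inj₂ (refl , refl)) (inj₁ (refl , refl)) = refl
other-end (inj₂ (_ , refl)) (inj₂ (_ , refl)) = refl

-- Indexed by the resulting entry, so that matching on the view rewrites `assign u v m f x y`
-- wherever it was abstracted.
data AssignView {k n} (u v : Fin n) (m : Maybe (Fin k)) (f : Table k n) (x y : Fin n) : Maybe (Fin k) → Set where
  inside  : SameEdge u v x y → AssignView u v m f x y m
  outside : ¬ SameEdge u v x y → AssignView u v m f x y (f x y)

assign-view : ∀ {k n} (u v : Fin n) (m : Maybe (Fin k)) f x y → AssignView u v m f x y (assign u v m f x y)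
assign-view u v m f x y = view (sameEdge? u v x y)
  where
  view : (e? : Dec (SameEdge u v x y)) → AssignView u v m f x y (if does e? then m else f x y)
  view (yes e) = inside e
  view (no ¬e) = outside ¬e

assign-inside : ∀ {k n} {u v : Fin n} (m : Maybe (Fin k)) f {x y} → SameEdge u v x y → assign u v m f x y ≡ m
assign-inside {u = u} {v} m f {x} {y} e with assign u v m f x y | assign-view u v m f x y
... | _ | inside _   = refl
... | _ | outside ¬e = ⊥-elim (¬e e)

assign-outside : ∀ {k n} {u v : Fin n} (m : Maybe (Fin k)) f {x y} → ¬ SameEdge u v x y → assign u v m f x y ≡ f x y
assign-outside {u = u} {v} m f {x} {y} ¬e with assign u v m f x y | assign-view u v m f x y
... | _ | inside e  = ⊥-elim (¬e e)
... | _ | outside _ = refl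

assign-sym : ∀ {k n} {u v : Fin n} (m : Maybe (Fin k)) {f} → (∀ x y → f x y ≡ f y x) →
             ∀ x y → assign u v m f x y ≡ assign u v m f y x
assign-sym {u = u} {v} m {f} f-sym x y with assign u v m f x y | assign-view u v m f x y
... | _ | inside e   = sym (assign-inside m f (sameEdge-sym e))
... | _ | outside ¬e = trans (f-sym x y) (sym (assign-outside m f (¬e ∘ sameEdge-sym)))

constant-on-edge : ∀ {k n} {f : Table k n} → (∀ x y → f x y ≡ f y x) →
                   ∀ {u v x y} → SameEdge u v x y → f x y ≡ f u v
constant-on-edge f-sym (inj₁ (refl , refl)) = refl
constant-on-edge f-sym (inj₂ (refl , refl)) = f-sym _ _

module _ {k n} {G : Graph n} {f : Table k n} (valid : Valid G f) where

  insert-valid : ∀ {u v} (u≢v : u ≢ v) (¬a : ¬ Adj G u v) → Valid (G ▷ insert u v u≢v ¬a) f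
  insert-valid _ _ .table-sym = table-sym valid
  insert-valid _ _ .table-off x y ¬a = table-off valid x y (¬a ∘ inj₁)
  insert-valid _ _ .table-proper = table-proper valid

  delete-valid : ∀ {u v} (a : Adj G u v) → Valid (G ▷ delete u v a) (assign u v nothing f)
  delete-valid a .table-sym = assign-sym nothing (table-sym valid)
  delete-valid {u} {v} a .table-off x y ¬a′ with assign u v nothing f x y | assign-view u v nothing f x y
  ... | _ | inside _   = refl
  ... | _ | outside ¬e = table-off valid x y λ a → ¬a′ (a , ¬e)
  delete-valid {u} {v} a .table-proper {x} {y} {z} p q
    with assign u v nothing f x y | assign-view u v nothing f x y
       | assign u v nothing f x z | assign-view u v nothing f x z
  delete-valid _ .table-proper () _ | _ | inside _  | _ | _
  delete-valid _ .table-proper _ () | _ | outside _ | _ | inside _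
  delete-valid _ .table-proper p q  | _ | outside _ | _ | outside _ = table-proper valid p q

  color-valid : ∀ {u v c} → Adj G u v → Free f c u → Free f c v → Valid G (assign u v (just c) f)
  color-valid {c = c} a free-u free-v .table-sym = assign-sym (just c) (table-sym valid)
  color-valid {u} {v} {c} a free-u free-v .table-off x y ¬a′
    with assign u v (just c) f x y | assign-view u v (just c) f x y
  ... | _ | outside _                   = table-off valid x y ¬a′
  ... | _ | inside (inj₁ (refl , refl)) = ⊥-elim (¬a′ a)
  ... | _ | inside (inj₂ (refl , refl)) = ⊥-elim (¬a′ (adj-sym G a))
  color-valid {u} {v} {c} a free-u free-v .table-proper {x} {y} {z} p q
    with assign u v (just c) f x y | assign-view u v (just c) f x y
       | assign u v (just c) f x z | assign-view u v (just c) f x z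
  ... | _ | outside _ | _ | outside _ = table-proper valid p q
  ... | _ | inside e  | _ | inside e′ = other-end e e′
  color-valid _ free-u free-v .table-proper refl q | _ | inside (inj₁ (refl , _)) | _ | outside _ = ⊥-elim (free-u _ q)
  color-valid _ free-u free-v .table-proper refl q | _ | inside (inj₂ (refl , _)) | _ | outside _ = ⊥-elim (free-v _ q)
  color-valid _ free-u free-v .table-proper p refl | _ | outside _ | _ | inside (inj₁ (refl , _)) = ⊥-elim (free-u _ p)
  color-valid _ free-u free-v .table-proper p refl | _ | outside _ | _ | inside (inj₂ (refl , _)) = ⊥-elim (free-v _ p)

valid-≈ : ∀ {k n} {G : Graph n} {f f′ : Table k n} → f′ ≈ f → Valid G f → Valid G f′
valid-≈ f′≈f valid .table-sym u v = trans (f′≈f u v) (trans (table-sym valid u v) (sym (f′≈f v u)))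
valid-≈ f′≈f valid .table-off u v ¬a = trans (f′≈f u v) (table-off valid u v ¬a)
valid-≈ f′≈f valid .table-proper p q = table-proper valid (trans (sym (f′≈f _ _)) p) (trans (sym (f′≈f _ _)) q)

infix 4 _⊑_

-- The order along which blocking is preserved: adding colours leaves fewer uncoloured edges and
-- fewer free colours.
_⊑_ : ∀ {k n} → Table k n → Table k n → Set
f ⊑ g = ∀ x y {c} → f x y ≡ just c → g x y ≡ just c

⊑-free : ∀ {k n} {f g : Table k n} → f ⊑ g → ∀ {c x} → Free g c x → Free f c x
⊑-free f⊑g free y eq = free y (f⊑g _ y eq)

⊑-nothing : ∀ {k n} {f g : Table k n} → f ⊑ g → ∀ {x y} → g x y ≡ nothing → f x y ≡ nothing
⊑-nothing {f = f} f⊑g {x} {y} none with f x y in eq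
... | nothing = refl
... | just c  = ⊥-elim (nothing≢just none (f⊑g x y eq))

≈⇒⊑ : ∀ {k n} {f f′ : Table k n} → f′ ≈ f → f ⊑ f′
≈⇒⊑ f′≈f x y eq = trans (f′≈f x y) eq

⊑-assign : ∀ {k n} {f : Table k n} → (∀ x y → f x y ≡ f y x) → ∀ {u v} → f u v ≡ nothing →
           ∀ {c} → f ⊑ assign u v (just c) f
⊑-assign {f = f} f-sym none x y eq =
  trans (assign-outside _ f λ e → nothing≢just (trans (constant-on-edge f-sym e) none) eq) eq

module _ {k n} {G : Graph n} {c : Fin k} where

  BlockedAt : Fin n → Table k n → Set
  BlockedAt u f = ∀ {w} → Adj G u w → f u w ≡ nothing → ¬ (Free f c u × Free f c w)

  blocked-⊑ : ∀ {f g u} → f ⊑ g → BlockedAt u f → BlockedAt u g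
  blocked-⊑ f⊑g blocked a none (free-u , free-w) =
    blocked a (⊑-nothing f⊑g none) (⊑-free f⊑g free-u , ⊑-free f⊑g free-w)

  module _ {f f′ : Table k n} {u : Fin n} (valid : Valid G f) where

    tryColor-valid : TryColor G c u f f′ → Valid G f′
    tryColor-valid (success w a _ free-u free-w f′≈) = valid-≈ f′≈ (color-valid valid a free-u free-w)
    tryColor-valid (failure _ f′≈f) = valid-≈ f′≈f valid

    tryColor-⊑ : TryColor G c u f f′ → f ⊑ f′
    tryColor-⊑ (success w a none _ _ f′≈) x y eq = ≈⇒⊑ f′≈ x y (⊑-assign (table-sym valid) none x y eq)
    tryColor-⊑ (failure _ f′≈f) = ≈⇒⊑ f′≈f

    -- One recoloured edge suffices: after a success `c` is in use at u and therefore blocked for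
    -- every other edge there.
    tryColor-blocked : TryColor G c u f f′ → BlockedAt u f′
    tryColor-blocked (success w _ _ _ _ f′≈) _ _ (free-u , _) =
      free-u w (trans (f′≈ _ _) (assign-inside (just c) f (inj₁ (refl , refl))))
    tryColor-blocked (failure stuck f′≈f) =
      blocked-⊑ (≈⇒⊑ f′≈f) (λ {w} → stuck w)

-- If some edge at x had colour d before and d is free now, that edge is the cleared one.
free-after-clear : ∀ {k n} {f : Table k n} → (∀ x y → f x y ≡ f y x) → ∀ {u v c} → f u v ≡ just c →
                   ∀ {d x} → Free (assign u v nothing f) d x → Free f d x ⊎ (d ≡ c × (x ≡ u ⊎ x ≡ v))
free-after-clear {f = f} f-sym {u} {v} {c} uv {d} {x} free with Fin.any? (λ y → ≡-dec Fin._≟_ (f x y) (just d))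
... | no unused = inj₁ λ y eq → unused (y , eq)
... | yes (y , eq) with sameEdge? u v x y
...   | no ¬e = ⊥-elim (free y (trans (assign-outside nothing f ¬e) eq))
...   | yes e = inj₂ (just-injective (trans (sym eq) (trans (constant-on-edge f-sym e) uv)) , end e)
  where
  end : SameEdge u v x y → x ≡ u ⊎ x ≡ v
  end (inj₁ (x≡u , _)) = inj₁ x≡u
  end (inj₂ (x≡v , _)) = inj₂ x≡v

-- Only the deletion of a coloured edge can free a colour. An edge colourable with d afterwards was
-- colourable before, unless d became free at one of its ends; then d = c and this end is u or v,
-- where the two attempts have blocked c.
greedyStep-maximal : ∀ {k n} {G : Graph n} {f f′ : Table k n} {x : Update G} →
                     Valid G f → Maximal G f → GreedyStep x f f′ → Maximal (G ▷ x) f′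
greedyStep-maximal {G = G} {f} {f′} valid maximal (insert-colored {u} {v} {¬a = ¬a} c _ _ f′≈) =
  λ where
    (inj₁ a) none d (free-x , free-y) → maximal a (⊑-nothing f⊑f′ none) d (⊑-free f⊑f′ free-x , ⊑-free f⊑f′ free-y)
    (inj₂ e) none → ⊥-elim (nothing≢just none (trans (f′≈ _ _) (assign-inside (just c) f e)))
  where
  f⊑f′ : f ⊑ f′
  f⊑f′ x y eq = ≈⇒⊑ f′≈ x y (⊑-assign (table-sym valid) (table-off valid _ _ ¬a) x y eq)
greedyStep-maximal {f = f} {f′} valid maximal (insert-uncolored stuck f′≈f) =
  λ where
    (inj₁ a) none d (free-x , free-y) → maximal a (⊑-nothing f⊑f′ none) d (⊑-free f⊑f′ free-x , ⊑-free f⊑f′ free-y)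
    (inj₂ (inj₁ (refl , refl))) none d (free-x , free-y) → stuck d (⊑-free f⊑f′ free-x , ⊑-free f⊑f′ free-y)
    (inj₂ (inj₂ (refl , refl))) none d (free-x , free-y) → stuck d (⊑-free f⊑f′ free-y , ⊑-free f⊑f′ free-x)
  where
  f⊑f′ : f ⊑ f′
  f⊑f′ = ≈⇒⊑ f′≈f
greedyStep-maximal {f = f} {f′} valid maximal (delete-uncolored _ f′≈f) =
  λ (a , _) none d (free-x , free-y) → maximal a (⊑-nothing f⊑f′ none) d (⊑-free f⊑f′ free-x , ⊑-free f⊑f′ free-y)
  where
  f⊑f′ : f ⊑ f′
  f⊑f′ = ≈⇒⊑ f′≈f
greedyStep-maximal {G = G} {f} {f′} valid maximal (delete-colored {u} {v} {a} c g uv try-u try-v)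
  {x} {y} xy none d (free-x , free-y) =
  contradict (free-after-clear (table-sym valid) uv (⊑-free f₁⊑f′ free-x))
             (free-after-clear (table-sym valid) uv (⊑-free f₁⊑f′ free-y))
  where
  G′ = G ▷ delete u v a
  f₁-valid : Valid G′ (assign u v nothing f)
  f₁-valid = delete-valid valid a
  g-valid : Valid G′ g
  g-valid = tryColor-valid f₁-valid try-u
  g⊑f′ : g ⊑ f′
  g⊑f′ = tryColor-⊑ g-valid try-v
  f₁⊑f′ : assign u v nothing f ⊑ f′
  f₁⊑f′ x y eq = g⊑f′ x y (tryColor-⊑ f₁-valid try-u x y eq)
  -- Established for the intermediate table `g`; the attempt at v only adds colours and cannot undo
  -- it.
  blocked-u : BlockedAt {G = G′} {c} u f′
  blocked-u = blocked-⊑ {G = G′} g⊑f′ (tryColor-blocked f₁-valid try-u)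
  blocked-v : BlockedAt {G = G′} {c} v f′
  blocked-v = tryColor-blocked g-valid try-v
  none′ : f′ y x ≡ nothing
  none′ = trans (table-sym (tryColor-valid g-valid try-v) y x) none
  contradict : Free f d x ⊎ (d ≡ c × (x ≡ u ⊎ x ≡ v)) → Free f d y ⊎ (d ≡ c × (y ≡ u ⊎ y ≡ v)) → ⊥
  contradict (inj₂ (refl , inj₁ refl)) _ = blocked-u xy none (free-x , free-y)
  contradict (inj₂ (refl , inj₂ refl)) _ = blocked-v xy none (free-x , free-y)
  contradict _ (inj₂ (refl , inj₁ refl)) = blocked-u (adj-sym G′ xy) none′ (free-y , free-x)
  contradict _ (inj₂ (refl , inj₂ refl)) = blocked-v (adj-sym G′ xy) none′ (free-y , free-x)
  contradict (inj₁ fx) (inj₁ fy) = maximal (proj₁ xy)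
    (trans (sym (assign-outside nothing f (proj₂ xy))) (⊑-nothing f₁⊑f′ none)) d (fx , fy)

-- Adjacency lists and colour arrays

Array : Set
Array = ℕ → ℕ → ℕ

-- The effect of setMem on the array it writes to; the two agree definitionally.
upd : ℕ → ℕ → ℕ → Array → Array
upd i j m A x y = if (x ≡ᵇ i) ∧ (y ≡ᵇ j) then m else A x y

data UpdView (i j m : ℕ) (A : Array) (x y : ℕ) : ℕ → Set where
  here      : x ≡ i → y ≡ j → UpdView i j m A x y m
  elsewhere : ¬ (x ≡ i × y ≡ j) → UpdView i j m A x y (A x y)

upd-view : ∀ i j m A x y → UpdView i j m A x y (upd i j m A x y)
upd-view i j m A x y = view ((x ≟ i) ×-dec (y ≟ j))
  where
  view : (e? : Dec (x ≡ i × y ≡ j)) → UpdView i j m A x y (if does e? then m else A x y)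
  view (yes (x≡i , y≡j)) = here x≡i y≡j
  view (no ¬e)           = elsewhere ¬e

set : ℕ → ℕ → (ℕ → ℕ) → ℕ → ℕ
set j m R y = if y ≡ᵇ j then m else R y

set-hit : ∀ {j m y} (R : ℕ → ℕ) → y ≡ j → set j m R y ≡ m
set-hit {j} {m} {y} R y≡j = go (y ≟ j)
  where
  go : (e? : Dec (y ≡ j)) → (if does e? then m else R y) ≡ m
  go (yes _)  = refl
  go (no y≢j) = ⊥-elim (y≢j y≡j)

set-miss : ∀ {j m y} (R : ℕ → ℕ) → y ≢ j → set j m R y ≡ R y
set-miss {j} {m} {y} R y≢j = go (y ≟ j)
  where
  go : (e? : Dec (y ≡ j)) → (if does e? then m else R y) ≡ R y
  go (yes y≡j) = ⊥-elim (y≢j y≡j)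
  go (no _)    = refl

upd-row : ∀ i j m A y → upd i j m A i y ≡ set j m (A i) y
upd-row i j m A y with upd i j m A i y | upd-view i j m A i y
... | _ | here _ y≡j   = sym (set-hit (A i) y≡j)
... | _ | elsewhere ¬e = sym (set-miss (A i) λ y≡j → ¬e (refl , y≡j))

upd-hit : ∀ i j m A → upd i j m A i j ≡ m
upd-hit i j m A = trans (upd-row i j m A j) (set-hit (A i) refl)

upd-other-row : ∀ {x i} j m A → x ≢ i → ∀ y → upd i j m A x y ≡ A x y
upd-other-row {x} {i} j m A x≢i y with upd i j m A x y | upd-view i j m A x y
... | _ | here x≡i _  = ⊥-elim (x≢i x≡i)
... | _ | elsewhere _ = refl

-- L lists the members of A in its first d cells, and P gives for each member
-- its index in that list.
record Row {n} (A : Fin n → Set) (L P : ℕ → ℕ) (d : ℕ) : Set where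
  field
    entry    : ∀ {i} → i < d → ∃[ w ] (A w × L i ≡ toℕ w × P (toℕ w) ≡ i)
    position : ∀ {w} → A w → P (toℕ w) < d × L (P (toℕ w)) ≡ toℕ w

open Row

row-cong : ∀ {n} {A A′ : Fin n → Set} {L L′ P P′ d d′} →
           (∀ {w} → A w → A′ w) → (∀ {w} → A′ w → A w) →
           (∀ i → L′ i ≡ L i) → (∀ i → P′ i ≡ P i) → d′ ≡ d → Row A L P d → Row A′ L′ P′ d′
row-cong to from L≗ P≗ refl row .entry i<d with entry row i<d
... | w , a , Li , Pw = w , to a , trans (L≗ _) Li , trans (P≗ _) Pw
row-cong {L = L} to from L≗ P≗ refl row .position {w} a with position row (from a)
... | Pw<d , LPw = subst (_< _) (sym (P≗ _)) Pw<d , trans (trans (L≗ _) (cong L (P≗ (toℕ w)))) LPw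

-- As v is new, writing its index overwrites that of no old member, and the written list cell d lies
-- beyond the old entries.
row-link : ∀ {n} {A : Fin n → Set} {L P d v} → Row A L P d → ¬ A v →
           Row (λ w → A w ⊎ w ≡ v) (set d (toℕ v) L) (set (toℕ v) d P) (suc d)
row-link {A = A} {L} {P} {d} {v} row ¬Av .entry {i} i<1+d with i ≟ d
... | yes i≡d = v , inj₂ refl , set-hit L i≡d , trans (set-hit P refl) (sym i≡d)
... | no i≢d with entry row (≤∧≢⇒< (≤-pred i<1+d) i≢d)
...   | w , a , Li , Pw = w , inj₁ a , trans (set-miss L i≢d) Li ,
        trans (set-miss P λ w≡v → ¬Av (subst A (Fin.toℕ-injective w≡v) a)) Pw
row-link {A = A} {L} {P} {d} {v} row ¬Av .position {w} (inj₂ refl)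
  rewrite set-hit {toℕ v} {d} P refl = n<1+n d , set-hit L refl
row-link {A = A} {L} {P} {d} {v} row ¬Av .position {w} (inj₁ a)
  rewrite set-miss {toℕ v} {d} {toℕ w} P (λ w≡v → ¬Av (subst A (Fin.toℕ-injective w≡v) a)) with position row a
... | Pw<d , LPw = m<n⇒m<1+n Pw<d , trans (set-miss L (<⇒≢ Pw<d)) LPw

-- The last entry of the list takes the place of v.
row-unlink : ∀ {n} {A : Fin n → Set} {L P d v} → Row A L P d → A v →
             Row (λ w → A w × w ≢ v) (set (P (toℕ v)) (L (pred d)) L) (set (L (pred d)) (P (toℕ v)) P) (pred d)
row-unlink {d = zero} row Av with position row Av
... | () , _
row-unlink {L = L} {P} {suc d} {v} row Av .entry {i} i<d with i ≟ P (toℕ v)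
... | no i≢p = let w , a , Li , Pw = entry row (m<n⇒m<1+n i<d) in
      w , (a , λ w≡v → i≢p (trans (sym Pw) (cong (P ∘ toℕ) w≡v))) , trans (set-miss L i≢p) Li ,
      trans (set-miss P (λ w≡l → <⇒≢ i<d (trans (sym Pw) (trans (cong P w≡l) P-last)))) Pw
  where
  P-last : P (L d) ≡ d
  P-last with entry row (n<1+n d)
  ... | w , _ , Ld , Pw = trans (cong P Ld) Pw
-- This cell now holds the former last entry. It is not v, for otherwise i = d, against i < d.
... | yes i≡p with entry row (n<1+n d)
...   | w , a , Ld , Pw = w , (a , λ w≡v → <⇒≢ i<d (trans i≡p (trans (cong (P ∘ toℕ) (sym w≡v)) Pw))) ,
        trans (set-hit L i≡p) Ld , trans (set-hit P (sym Ld)) (sym i≡p)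
-- The moved entry gets the old index of v, which is not d because w and v differ; every other entry
-- keeps its index.
row-unlink {L = L} {P} {suc d} {v} row Av .position {w} (a , w≢v) with toℕ w ≟ L d
... | yes w≡l rewrite set-hit {L d} {P (toℕ v)} P w≡l =
  ≤∧≢⇒< (≤-pred (proj₁ (position row Av))) p≢d , trans (set-hit L refl) (sym w≡l)
  where
  p≢d : P (toℕ v) ≢ d
  p≢d p≡d = w≢v (Fin.toℕ-injective (trans w≡l (trans (cong L (sym p≡d)) (proj₂ (position row Av)))))
... | no w≢l rewrite set-miss {L d} {P (toℕ v)} P w≢l =
  ≤∧≢⇒< (≤-pred (proj₁ (position row a))) (λ Pw≡d → w≢l (trans (sym LPw) (cong L Pw≡d))) ,
  trans (set-miss L (λ Pw≡p → w≢v (Fin.toℕ-injective (trans (sym LPw) (trans (cong L Pw≡p) (proj₂ (position row Av))))))) LPw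
  where
  LPw = proj₂ (position row a)

-- The index table `P` recovers a cell from its content, so the list has no repetitions.
row-length≤count : ∀ {n} {A : Fin n → Set} {L P d} (A? : ∀ w → Dec (A w)) → Row A L P d → d ≤ count A?
row-length≤count {n} {A} {L} {P} {d} A? row = begin
  d                                   ≡⟨ sum-ones d ⟨
  sum {d} (λ _ → 1)                   ≤⟨ sum-mono (λ i → let w , a , Li , _ = entry row (Fin.toℕ<n i) in 1≤count (R? i) (Li , a)) ⟩
  sum (λ i → count (R? i))            ≤⟨ sum-count≤count R? A? (λ p q → Fin.toℕ-injective (trans (sym (index p)) (index q))) proj₂ ⟩
  count A?                            ∎
  where
  open ≤-Reasoning
  R? : ∀ (i : Fin d) (w : Fin n) → Dec (L (toℕ i) ≡ toℕ w × A w)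
  R? i w = (L (toℕ i) ≟ toℕ w) ×-dec A? w
  index : ∀ {i : Fin d} {w} → L (toℕ i) ≡ toℕ w × A w → P (toℕ w) ≡ toℕ i
  index {i} {w} (Li≡w , _) with entry row (Fin.toℕ<n i)
  ... | w′ , _ , Li≡w′ , Pw′ = trans (cong P (trans (sym Li≡w) Li≡w′)) Pw′

-- For arbitrary relations, since `link` and `unlink` treat one direction of an edge at a time and
-- adjacency is not symmetric between the two calls.
Neighbours : ∀ {n} → (Fin n → Fin n → Set) → (L P D : Array) → Set
Neighbours A L P D = ∀ x → Row (A x) (L (toℕ x)) (P (toℕ x)) (D (toℕ x) 0)

toℕ-≢ : ∀ {n} {x y : Fin n} → x ≢ y → toℕ x ≢ toℕ y
toℕ-≢ x≢y = x≢y ∘ Fin.toℕ-injective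

neighbours-link : ∀ {n} {A : Fin n → Fin n → Set} {L P D u v} → Neighbours A L P D → ¬ A u v →
                  Neighbours (λ x y → A x y ⊎ (x ≡ u × y ≡ v))
                    (upd (toℕ u) (D (toℕ u) 0) (toℕ v) L) (upd (toℕ u) (toℕ v) (D (toℕ u) 0) P)
                    (upd (toℕ u) 0 (suc (D (toℕ u) 0)) D)
neighbours-link {L = L} {P} {D} {u} {v} nb ¬a x with x Fin.≟ u
... | yes refl = row-cong (λ { (inj₁ a) → inj₁ a ; (inj₂ w≡v) → inj₂ (refl , w≡v) })
                          (λ { (inj₁ a) → inj₁ a ; (inj₂ (_ , w≡v)) → inj₂ w≡v })
                          (upd-row (toℕ u) _ _ L) (upd-row (toℕ u) _ _ P) (upd-hit (toℕ u) 0 _ D) (row-link (nb u) ¬a)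
... | no x≢u   = row-cong inj₁ (λ { (inj₁ a) → a ; (inj₂ (x≡u , _)) → ⊥-elim (x≢u x≡u) })
                          (upd-other-row _ _ L (toℕ-≢ x≢u)) (upd-other-row _ _ P (toℕ-≢ x≢u))
                          (upd-other-row 0 _ D (toℕ-≢ x≢u) 0) (nb x)

neighbours-unlink : ∀ {n} {A : Fin n → Fin n → Set} {L P D u v} → Neighbours A L P D → A u v →
                    let d = pred (D (toℕ u) 0) ; p = P (toℕ u) (toℕ v) ; l = L (toℕ u) d in
                    Neighbours (λ x y → A x y × ¬ (x ≡ u × y ≡ v))
                      (upd (toℕ u) p l L) (upd (toℕ u) l p P) (upd (toℕ u) 0 d D)
neighbours-unlink {L = L} {P} {D} {u} {v} nb a x with x Fin.≟ u
... | yes refl = row-cong (λ (a , w≢v) → a , λ (_ , w≡v) → w≢v w≡v) (λ (a , ¬e) → a , λ w≡v → ¬e (refl , w≡v))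
                          (upd-row (toℕ u) _ _ L) (upd-row (toℕ u) _ _ P) (upd-hit (toℕ u) 0 _ D) (row-unlink (nb u) a)
... | no x≢u   = row-cong (λ a → a , λ (x≡u , _) → x≢u x≡u) proj₁
                          (upd-other-row _ _ L (toℕ-≢ x≢u)) (upd-other-row _ _ P (toℕ-≢ x≢u))
                          (upd-other-row 0 _ D (toℕ-≢ x≢u) 0) (nb x)

degree≤Δ : ∀ {n} (G : Graph n) u → degree G u ≤ Δ G
degree≤Δ {n} G u = All.lookup (xs≤max 0 (map (degree G) (allFin n))) (∈-map⁺ (degree G) (∈-allFin u))

length≤Δ : ∀ {n} (G : Graph n) {L P D} → Neighbours (Adj G) L P D → ∀ u → D (toℕ u) 0 ≤ Δ G
length≤Δ G nb u = ≤-trans (row-length≤count (adj? G u) (nb u))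
  (≤-trans (≤-reflexive (sym (degree≡count G u))) (degree≤Δ G u))

coloredDegree≤Δ : ∀ {k n} {G : Graph n} {f : Table k n} → Valid G f → ∀ u → coloredDegree f u ≤ Δ G
coloredDegree≤Δ {G = G} {f} valid u = begin
  coloredDegree f u     ≤⟨ sum-mono (λ v → 𝟙-mono (colored? f u v) (adj? G u v) (adjacent v)) ⟩
  count (adj? G u)      ≡⟨ degree≡count G u ⟨
  degree G u            ≤⟨ degree≤Δ G u ⟩
  Δ G                   ∎
  where
  open ≤-Reasoning
  adjacent : ∀ v → Colored f u v → Adj G u v
  adjacent v t with adj? G u v
  ... | yes a = a
  ... | no ¬a = ⊥-elim (nothing⇒¬Colored f (table-off valid u v ¬a) t)

-- C holds the colour table and F the colours that are in use at each vertex;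
-- colour c is the number suc (toℕ c) in both.
record Colors {k n} (f : Table k n) (C F : Array) : Set where
  field
    table  : ∀ u v → C (toℕ u) (toℕ v) ≡ encode (f u v)
    unused : ∀ {u c} → F (toℕ u) (suc (toℕ c)) ≡ 0 → Free f c u
    unset  : ∀ {u c} → Free f c u → F (toℕ u) (suc (toℕ c)) ≡ 0

open Colors

table-assign : ∀ {k n} {f : Table k n} {C} → (∀ x y → C (toℕ x) (toℕ y) ≡ encode (f x y)) → ∀ u v m x y →
               upd (toℕ v) (toℕ u) (encode m) (upd (toℕ u) (toℕ v) (encode m) C) (toℕ x) (toℕ y) ≡
               encode (assign u v m f x y)
table-assign {f = f} {C} table u v m x y
  with upd (toℕ v) (toℕ u) (encode m) (upd (toℕ u) (toℕ v) (encode m) C) (toℕ x) (toℕ y)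
     | upd-view (toℕ v) (toℕ u) (encode m) (upd (toℕ u) (toℕ v) (encode m) C) (toℕ x) (toℕ y)
... | _ | here x≡v y≡u = cong encode (sym (assign-inside m f (inj₂ (Fin.toℕ-injective x≡v , Fin.toℕ-injective y≡u))))
... | _ | elsewhere ¬e
  with upd (toℕ u) (toℕ v) (encode m) C (toℕ x) (toℕ y) | upd-view (toℕ u) (toℕ v) (encode m) C (toℕ x) (toℕ y)
...   | _ | here x≡u y≡v = cong encode (sym (assign-inside m f (inj₁ (Fin.toℕ-injective x≡u , Fin.toℕ-injective y≡v))))
...   | _ | elsewhere ¬e′ = trans (table x y) (cong encode (sym (assign-outside m f
  λ { (inj₁ (refl , refl)) → ¬e′ (refl , refl) ; (inj₂ (refl , refl)) → ¬e (refl , refl) })))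

data FlagView {k n} (u v : Fin n) (c : Fin k) (m : ℕ) (F : Array) (x : Fin n) (d : Fin k) : ℕ → Set where
  set-flag : c ≡ d → x ≡ u ⊎ x ≡ v → FlagView u v c m F x d m
  old-flag : ¬ (c ≡ d × (x ≡ u ⊎ x ≡ v)) → FlagView u v c m F x d (F (toℕ x) (suc (toℕ d)))

flag-view : ∀ {k n} (u v : Fin n) (c : Fin k) m F x d → FlagView u v c m F x d
            (upd (toℕ v) (suc (toℕ c)) m (upd (toℕ u) (suc (toℕ c)) m F) (toℕ x) (suc (toℕ d)))
flag-view u v c m F x d
  with upd (toℕ v) (suc (toℕ c)) m (upd (toℕ u) (suc (toℕ c)) m F) (toℕ x) (suc (toℕ d))
     | upd-view (toℕ v) (suc (toℕ c)) m (upd (toℕ u) (suc (toℕ c)) m F) (toℕ x) (suc (toℕ d))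
... | _ | here x≡v d≡c = set-flag (sym (Fin.toℕ-injective (suc-injective d≡c))) (inj₂ (Fin.toℕ-injective x≡v))
... | _ | elsewhere ¬e
  with upd (toℕ u) (suc (toℕ c)) m F (toℕ x) (suc (toℕ d))
     | upd-view (toℕ u) (suc (toℕ c)) m F (toℕ x) (suc (toℕ d))
...   | _ | here x≡u d≡c = set-flag (sym (Fin.toℕ-injective (suc-injective d≡c))) (inj₁ (Fin.toℕ-injective x≡u))
...   | _ | elsewhere ¬e′ = old-flag λ { (refl , inj₁ refl) → ¬e′ (refl , refl) ; (refl , inj₂ refl) → ¬e (refl , refl) }

-- As uv was uncoloured, no colour is overwritten: a colour free afterwards was free before, and its
-- flag is already zero.
colors-assign : ∀ {k n} {f : Table k n} {C F} → Colors f C F → (∀ x y → f x y ≡ f y x) →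
                ∀ {u v} c → f u v ≡ nothing →
                Colors (assign u v (just c) f)
                  (upd (toℕ v) (toℕ u) (suc (toℕ c)) (upd (toℕ u) (toℕ v) (suc (toℕ c)) C))
                  (upd (toℕ v) (suc (toℕ c)) 1 (upd (toℕ u) (suc (toℕ c)) 1 F))
colors-assign {C = C} colors f-sym {u} {v} c none .table = table-assign {C = C} (table colors) u v (just c)
colors-assign {f = f} {C} {F} colors f-sym {u} {v} c none .unused {x} {d} flag y eq
  with upd (toℕ v) (suc (toℕ c)) 1 (upd (toℕ u) (suc (toℕ c)) 1 F) (toℕ x) (suc (toℕ d)) | flag-view u v c 1 F x d
colors-assign {f = f} colors f-sym {u} {v} c none .unused {x} {d} () y eq | _ | set-flag _ _
colors-assign {f = f} colors f-sym {u} {v} c none .unused {x} {d} flag y eq | _ | old-flag ¬new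
  with assign u v (just c) f x y | assign-view u v (just c) f x y
colors-assign colors f-sym c none .unused flag y refl | _ | old-flag ¬new | _ | inside (inj₁ (x≡u , _)) = ¬new (refl , inj₁ x≡u)
colors-assign colors f-sym c none .unused flag y refl | _ | old-flag ¬new | _ | inside (inj₂ (x≡v , _)) = ¬new (refl , inj₂ x≡v)
colors-assign colors f-sym c none .unused flag y eq | _ | old-flag ¬new | _ | outside _ = unused colors flag y eq
colors-assign {f = f} {C} {F} colors f-sym {u} {v} c none .unset {x} {d} free
  with upd (toℕ v) (suc (toℕ c)) 1 (upd (toℕ u) (suc (toℕ c)) 1 F) (toℕ x) (suc (toℕ d)) | flag-view u v c 1 F x d
... | _ | set-flag refl (inj₁ refl) = ⊥-elim (free v (assign-inside (just c) f (inj₁ (refl , refl))))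
... | _ | set-flag refl (inj₂ refl) = ⊥-elim (free u (assign-inside (just c) f (inj₂ (refl , refl))))
... | _ | old-flag _ = unset colors (⊑-free (⊑-assign f-sym none) free)

-- Properness justifies resetting the flags: no second edge at u or v keeps c in use.
colors-clear : ∀ {k n} {f : Table k n} {C F} → Colors f C F → (∀ x y → f x y ≡ f y x) → Proper f →
               ∀ {u v} c → f u v ≡ just c →
               Colors (assign u v nothing f)
                 (upd (toℕ v) (toℕ u) 0 (upd (toℕ u) (toℕ v) 0 C))
                 (upd (toℕ v) (suc (toℕ c)) 0 (upd (toℕ u) (suc (toℕ c)) 0 F))
colors-clear {C = C} colors f-sym f-proper {u} {v} c uv .table = table-assign {C = C} (table colors) u v nothing
colors-clear {f = f} {C} {F} colors f-sym f-proper {u} {v} c uv .unused {x} {d} flag y eq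
  with assign u v nothing f x y | assign-view u v nothing f x y
colors-clear colors f-sym f-proper {u} {v} c uv .unused {x} {d} flag y () | _ | inside _
colors-clear {f = f} {C} {F} colors f-sym f-proper {u} {v} c uv .unused {x} {d} flag y eq | _ | outside ¬e
  with upd (toℕ v) (suc (toℕ c)) 0 (upd (toℕ u) (suc (toℕ c)) 0 F) (toℕ x) (suc (toℕ d)) | flag-view u v c 0 F x d
... | _ | old-flag _                = unused colors flag y eq
... | _ | set-flag refl (inj₁ refl) = ¬e (inj₁ (refl , f-proper eq uv))
... | _ | set-flag refl (inj₂ refl) = ¬e (inj₂ (refl , f-proper eq (trans (f-sym v u) uv)))
colors-clear {f = f} {C} {F} colors f-sym f-proper {u} {v} c uv .unset {x} {d} free
  with upd (toℕ v) (suc (toℕ c)) 0 (upd (toℕ u) (suc (toℕ c)) 0 F) (toℕ x) (suc (toℕ d)) | flag-view u v c 0 F x d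
... | _ | set-flag _ _  = refl
... | _ | old-flag ¬new with free-after-clear f-sym uv free
...   | inj₁ free-f      = unset colors free-f
...   | inj₂ (refl , at) = ⊥-elim (¬new (refl , at))

-- The program

-- Array 0 holds the colours, array 1 the colours in use at each vertex, array
-- 2 the adjacency lists, array 3 the indices in these lists, and array 4 their
-- lengths.  Register 4 holds a colour, 5 a search index, 6 a neighbour.

link : Reg → Reg → Cmd
link a b =
  2 [ reg a , 4 [ reg a , lit 0 ] ]≔ reg b ⨟
  3 [ reg a , reg b ]≔ (4 [ reg a , lit 0 ]) ⨟
  4 [ reg a , lit 0 ]≔ inc (4 [ reg a , lit 0 ])

unlink : Reg → Reg → Cmd
unlink a b =
  5 ≔ (2 [ reg a , dec (4 [ reg a , lit 0 ]) ]) ⨟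
  2 [ reg a , 3 [ reg a , reg b ] ]≔ reg 5 ⨟
  3 [ reg a , reg 5 ]≔ (3 [ reg a , reg b ]) ⨟
  4 [ reg a , lit 0 ]≔ dec (4 [ reg a , lit 0 ])

paint : Reg → Reg → Cmd
paint a b =
  0 [ reg a , reg b ]≔ reg 4 ⨟
  0 [ reg b , reg a ]≔ reg 4 ⨟
  1 [ reg a , reg 4 ]≔ lit 1 ⨟
  1 [ reg b , reg 4 ]≔ lit 1

erase : Reg → Reg → Cmd
erase a b =
  0 [ reg a , reg b ]≔ lit 0 ⨟
  0 [ reg b , reg a ]≔ lit 0 ⨟
  1 [ reg a , reg 4 ]≔ lit 0 ⨟
  1 [ reg b , reg 4 ]≔ lit 0

searchFrom0 : Test → Cmd
searchFrom0 b = 5 ≔ lit 0 ⨟ While b Do (5 ≔ inc (reg 5))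

-- Register 5 counts colours from 0 while flags are stored from 1, so the first conjunct says i < k.
-- The scan ends at the least common free colour, or at i = k if there is none.
colorRejected : Test
colorRejected = (inc (reg 5) <= reg 0) and
  neg (((1 [ reg 2 , inc (reg 5) ]) == lit 0) and ((1 [ reg 3 , inc (reg 5) ]) == lit 0))

neighbourRejected : Reg → Test
neighbourRejected a = (inc (reg 5) <= (4 [ reg a , lit 0 ])) and
  neg (((0 [ reg a , 2 [ reg a , reg 5 ] ]) == lit 0) and ((1 [ 2 [ reg a , reg 5 ] , reg 4 ]) == lit 0))

-- Whether the colour is free at the vertex itself does not depend on the neighbour, so it is tested
-- once, after the scan.
tryPaint : Reg → Cmd
tryPaint a =
  searchFrom0 (neighbourRejected a) ⨟
  If (inc (reg 5) <= (4 [ reg a , lit 0 ])) and ((1 [ reg a , reg 4 ]) == lit 0)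
  Then (6 ≔ (2 [ reg a , reg 5 ]) ⨟ paint a 6)
  Else skip

colorInserted : Cmd
colorInserted = searchFrom0 colorRejected ⨟ 4 ≔ inc (reg 5) ⨟ If reg 4 <= reg 0 Then paint 2 3 Else skip

recolorDeleted : Cmd
recolorDeleted =
  4 ≔ (0 [ reg 2 , reg 3 ]) ⨟
  If reg 4 == lit 0 Then skip Else (erase 2 3 ⨟ tryPaint 2 ⨟ tryPaint 3)

-- The lists are updated before the colours, so the searches for an edge to recolour run over the
-- new graph, whose Δ bounds the time.
greedy : DynamicAlgorithm
greedy .onInsert = (link 2 3 ⨟ link 3 2) ⨟ colorInserted
greedy .onDelete = (unlink 2 3 ⨟ unlink 3 2) ⨟ recolorDeleted

-- Running branches, searches and colour writes

If-run : ∀ {P : Set} {b c d s} (P? : Dec P) → evalT b s ≡ does P? →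
         (Q : State → ℕ → Set) →
         (P → ∃[ s′ ] ∃[ t ] (c , s ⇓ s′ , t × Q s′ (suc t))) →
         (¬ P → ∃[ s′ ] ∃[ t ] (d , s ⇓ s′ , t × Q s′ (suc t))) →
         ∃[ s′ ] ∃[ t ] ((If b Then c Else d) , s ⇓ s′ , t × Q s′ t)
If-run (yes p) b≡ Q then else = let s′ , t , run , q = then p in s′ , suc t , ⇓-true b≡ run , q
If-run (no ¬p) b≡ Q then else = let s′ , t , run , q = else ¬p in s′ , suc t , ⇓-false b≡ run , q

record SameBut5 (s s′ : State) : Set where
  constructor same
  field
    same-regs : ∀ q → q ≢ 5 → regs s′ q ≡ regs s q
    same-mem  : mem s′ ≡ mem s

open SameBut5

setReg5-same : ∀ {s s′} m → SameBut5 s s′ → SameBut5 s (setReg 5 m s′)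
setReg5-same {s} {s′} m (same regs≡ mem≡) = same regs≡′ mem≡
  where
  regs≡′ : ∀ q → q ≢ 5 → regs (setReg 5 m s′) q ≡ regs s q
  regs≡′ q q≢5 = trans (set-miss (regs s′) q≢5) (regs≡ q q≢5)

record Found (P : ℕ → Set) (s₀ s′ : State) : Set where
  field
    others : SameBut5 s₀ s′
    fails  : ¬ P (regs s′ 5)
    before : ∀ {l} → l < regs s′ 5 → P l

open Found

module _ {P : ℕ → Set} (P? : ∀ i → Dec (P i)) {b : Test} {s₀ : State}
         (test : ∀ {s} → SameBut5 s₀ s → evalT b s ≡ does (P? (regs s 5))) where

  -- The fuel is the distance to an index known to stop the loop. An iteration costs two steps, test
  -- and increment, and the exit one; the time equation says this without subtraction.
  search-loop : ∀ fuel {i s} → SameBut5 s₀ s → regs s 5 ≡ i → ¬ P (fuel + i) → (∀ {l} → l < i → P l) →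
                ∃[ s′ ] ∃[ t ] ((While b Do (5 ≔ inc (reg 5))) , s ⇓ s′ , t ×
                                Found P s₀ s′ × t + 2 * i ≡ 1 + 2 * regs s′ 5)
  search-loop fuel {i} {s} agree refl stop below with P? i
  ... | no ¬p = s , 1 , ⇓-exit (trans (test agree) (dec-false (P? i) ¬p)) ,
    record { others = agree ; fails = ¬p ; before = below } , refl
  search-loop zero {i} {s} agree refl stop below | yes p = ⊥-elim (stop p)
  search-loop (suc fuel) {i} {s} agree refl stop below | yes p =
    let s′ , t , run , found , time = search-loop fuel (setReg5-same (suc i) agree) refl
          (stop ∘ subst P (+-suc fuel i)) (λ {l} l<1+i → [ below , (λ { refl → p }) ]′ (m≤n⇒m<n∨m≡n (≤-pred l<1+i)))
    in s′ , suc (1 + t) , ⇓-iterate (trans (test agree) (dec-true (P? i) p)) ⇓-reg run , found ,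
       trans (shift t i) time
    where
    shift : ∀ t i → 2 + t + 2 * i ≡ t + 2 * suc i
    shift = solve-∀

  search-run : ∀ bound → ¬ P bound →
               ∃[ s′ ] ∃[ t ] (searchFrom0 b , s₀ ⇓ s′ , t × Found P s₀ s′ × t ≡ 2 + 2 * regs s′ 5)
  search-run bound stop =
    let s′ , t , run , found , time = search-loop bound (setReg5-same 0 (same (λ _ _ → refl) refl)) refl
          (stop ∘ subst P (+-identityʳ bound)) λ ()
    in s′ , suc t , ⇓-seq ⇓-reg run , found , cong suc (trans (sym (+-identityʳ t)) time)

-- Lists and colours are described independently, because during a deletion the lists already omit
-- an edge that the table may still colour.
record Memory {k n} (A : Fin n → Fin n → Set) (f : Table k n) (s : State) : Set where
  constructor memory
  field
    neighbours : Neighbours A (mem s 2) (mem s 3) (mem s 4)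
    colors     : Colors f (mem s 0) (mem s 1)

open Memory

memory-cong : ∀ {k n A} {f : Table k n} {s s′} → mem s′ ≡ mem s → Memory A f s → Memory A f s′
memory-cong refl (memory nb cs) = memory nb cs

paint-run : ∀ {k n A} {f : Table k n} {s a b u v c} → Memory A f s → (∀ x y → f x y ≡ f y x) →
            regs s a ≡ toℕ u → regs s b ≡ toℕ v → regs s 4 ≡ suc (toℕ c) → f u v ≡ nothing →
            ∃[ s′ ] (paint a b , s ⇓ s′ , 4 × Memory A (assign u v (just c) f) s′ × regs s′ ≡ regs s)
paint-run {f = f} {s} {u = u} {v} {c} (memory nb cs) f-sym a≡u b≡v r≡c none =
  _ , ⇓-seq ⇓-mem (⇓-seq ⇓-mem (⇓-seq ⇓-mem ⇓-mem)) , memory nb (painted a≡u b≡v r≡c) , refl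
  where
  -- Register contents are generalised to variables so that matching on `refl` turns them into
  -- vertices and colours.
  painted : ∀ {x y z} → x ≡ toℕ u → y ≡ toℕ v → z ≡ suc (toℕ c) →
            Colors (assign u v (just c) f) (upd y x z (upd x y z (mem s 0))) (upd y z 1 (upd x z 1 (mem s 1)))
  painted refl refl refl = colors-assign cs f-sym c none

erase-run : ∀ {k n A} {f : Table k n} {s a b u v c} → Memory A f s → (∀ x y → f x y ≡ f y x) → Proper f →
            regs s a ≡ toℕ u → regs s b ≡ toℕ v → regs s 4 ≡ suc (toℕ c) → f u v ≡ just c →
            ∃[ s′ ] (erase a b , s ⇓ s′ , 4 × Memory A (assign u v nothing f) s′ × regs s′ ≡ regs s)
erase-run {f = f} {s} {u = u} {v} {c} (memory nb cs) f-sym f-proper a≡u b≡v r≡c uv =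
  _ , ⇓-seq ⇓-mem (⇓-seq ⇓-mem (⇓-seq ⇓-mem ⇓-mem)) , memory nb (erased a≡u b≡v r≡c) , refl
  where
  erased : ∀ {x y z} → x ≡ toℕ u → y ≡ toℕ v → z ≡ suc (toℕ c) →
           Colors (assign u v nothing f) (upd y x 0 (upd x y 0 (mem s 0))) (upd y z 0 (upd x z 0 (mem s 1)))
  erased refl refl refl = colors-clear cs f-sym f-proper c uv

Tried : ∀ {k n} → Graph n → Fin k → Reg → Fin n → Table k n → State → Set
Tried G c a u f s =
  ∃[ s′ ] ∃[ t ] ∃[ f′ ] (tryPaint a , s ⇓ s′ , t × t ≤ 8 + 2 * Δ G × TryColor G c u f f′ ×
                          Memory (Adj G) f′ s′ × (∀ q → q ≢ 5 → q ≢ 6 → regs s′ q ≡ regs s q))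

tryPaint-run : ∀ {k n} {G : Graph n} {f : Table k n} {s a u c} → a ≢ 5 → a ≢ 6 →
               Valid G f → Memory (Adj G) f s → regs s a ≡ toℕ u → regs s 4 ≡ suc (toℕ c) →
               Tried G c a u f s
tryPaint-run {k} {n} {G} {f} {s} {a} {u} {c} a≢5 a≢6 valid m a≡u r≡c =
  let s₁ , t₁ , run₁ , found , time₁ = search-run P? test (D (toℕ u) 0) (λ p → <-irrefl refl (proj₁ p))
      s₂ , t₂ , run₂ , f′ , time₂ , tried , m₂ , kept = branch s₁ found
  in s₂ , t₁ + t₂ , f′ , ⇓-seq run₁ run₂ ,
     bound (subst (_≤ 8 + 2 * regs s₁ 5) (cong (_+ t₂) (sym time₁)) (total (regs s₁ 5) time₂)) (index≤Δ found) ,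
     tried , m₂ , kept
  where
  C = mem s 0
  F = mem s 1
  L = mem s 2
  D = mem s 4

  Rejected : ℕ → ℕ → ℕ → Set
  Rejected x z i = suc i ≤ D x 0 × ¬ (C x (L x i) ≡ 0 × F (L x i) z ≡ 0)

  rejected? : ∀ x z i → Dec (Rejected x z i)
  rejected? x z i = (suc i ≤? D x 0) ×-dec ¬? ((C x (L x i) ≟ 0) ×-dec (F (L x i) z ≟ 0))

  P : ℕ → Set
  P = Rejected (toℕ u) (suc (toℕ c))

  P? : ∀ i → Dec (P i)
  P? = rejected? (toℕ u) (suc (toℕ c))

  -- `rejected?` is composed so that its `does` computes to the Boolean of the program's test; only
  -- the register contents have to be rewritten.
  test : ∀ {s₁} → SameBut5 s s₁ → evalT (neighbourRejected a) s₁ ≡ does (P? (regs s₁ 5))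
  test {s₁} (same regs≡ refl) = cong₂ (λ x z → does (rejected? x z (regs s₁ 5)))
    (trans (regs≡ a a≢5) a≡u) (trans (regs≡ 4 λ ()) r≡c)

  index≤Δ : ∀ {s₁} → Found P s s₁ → regs s₁ 5 ≤ Δ G
  index≤Δ {s₁} found with regs s₁ 5 | before found
  ... | zero  | _  = z≤n
  ... | suc i | ps = ≤-trans (proj₁ (ps (n<1+n i))) (length≤Δ G {L} {mem s 3} {D} (neighbours m) u)

  -- The 6 covers one test, one assignment and the four writes of `paint`.
  total : ∀ i {t} → t ≤ 6 → 2 + 2 * i + t ≤ 8 + 2 * i
  total i {t} t≤6 = begin
    2 + 2 * i + t ≤⟨ +-monoʳ-≤ (2 + 2 * i) t≤6 ⟩
    2 + 2 * i + 6 ≡⟨ shift i ⟩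
    8 + 2 * i     ∎
    where
    open ≤-Reasoning
    shift : ∀ i → 2 + 2 * i + 6 ≡ 8 + 2 * i
    shift = solve-∀

  bound : ∀ {t i d} → t ≤ 8 + 2 * i → i ≤ d → t ≤ 8 + 2 * d
  bound t≤ i≤d = ≤-trans t≤ (+-monoʳ-≤ 8 (*-monoʳ-≤ 2 i≤d))

  Goal : State → ℕ → Set
  Goal s₂ t = ∃[ f′ ] (t ≤ 6 × TryColor G c u f f′ × Memory (Adj G) f′ s₂ ×
                       (∀ q → q ≢ 5 → q ≢ 6 → regs s₂ q ≡ regs s q))

  branch : ∀ s₁ → Found P s s₁ → ∃[ s₂ ] ∃[ t ]
           ((If (inc (reg 5) <= (4 [ reg a , lit 0 ])) and ((1 [ reg a , reg 4 ]) == lit 0)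
             Then (6 ≔ (2 [ reg a , reg 5 ]) ⨟ paint a 6) Else skip) , s₁ ⇓ s₂ , t × Goal s₂ t)
  branch s₁@(⟨ ρ , _ ⟩) record { others = same regs≡ refl ; fails = ¬p ; before = ps } =
    If-run (success? (toℕ u) (suc (toℕ c))) (cong₂ (λ x z → does (success? x z)) ρa≡u ρ4≡c) Goal paints fails-to-paint
    where
    i = ρ 5
    ρa≡u : ρ a ≡ toℕ u
    ρa≡u = trans (regs≡ a a≢5) a≡u
    ρ4≡c : ρ 4 ≡ suc (toℕ c)
    ρ4≡c = trans (regs≡ 4 λ ()) r≡c

    success? : ∀ x z → Dec (suc i ≤ D x 0 × F x z ≡ 0)
    success? x z = (suc i ≤? D x 0) ×-dec (F x z ≟ 0)

    paints : suc i ≤ D (toℕ u) 0 × F (toℕ u) (suc (toℕ c)) ≡ 0 →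
             ∃[ s₂ ] ∃[ t ] ((6 ≔ (2 [ reg a , reg 5 ]) ⨟ paint a 6) , s₁ ⇓ s₂ , t × Goal s₂ (suc t))
    paints (i<D , unused-u) with entry (neighbours m u) i<D
    ... | w , uw , Li≡w , _ =
      let s₂ , run , m₂ , regs₂ = paint-run {a = a} {b = 6} (memory-cong {s = s} refl m) (table-sym valid)
            (trans (set-miss ρ a≢6) ρa≡u) (trans (cong (λ x → L x i) ρa≡u) Li≡w) ρ4≡c none
      in s₂ , 5 , ⇓-seq ⇓-reg run , assign u w (just c) f , ≤-refl ,
         success w uw none (unused (colors m) unused-u) free-w (λ _ _ → refl) , m₂ ,
         λ q q≢5 q≢6 → trans (cong (λ r → r q) regs₂) (trans (set-miss ρ q≢6) (regs≡ q q≢5))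
      where
      accepted : C (toℕ u) (L (toℕ u) i) ≡ 0 × F (L (toℕ u) i) (suc (toℕ c)) ≡ 0
      accepted = decidable-stable ((C _ _ ≟ 0) ×-dec (F _ _ ≟ 0)) λ ¬acc → ¬p (i<D , ¬acc)
      none : f u w ≡ nothing
      none with f u w | trans (sym (table (colors m) u w)) (trans (cong (C (toℕ u)) (sym Li≡w)) (proj₁ accepted))
      ... | nothing | _ = refl
      free-w : Free f c w
      free-w = unused (colors m) (trans (cong (λ x → F x (suc (toℕ c))) (sym Li≡w)) (proj₂ accepted))

    fails-to-paint : ¬ (suc i ≤ D (toℕ u) 0 × F (toℕ u) (suc (toℕ c)) ≡ 0) →
                     ∃[ s₂ ] ∃[ t ] (skip , s₁ ⇓ s₂ , t × Goal s₂ (suc t))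
    fails-to-paint ¬success = s₁ , 1 , ⇓-skip , f , s≤s (s≤s z≤n) , failure stuck (λ _ _ → refl) ,
      memory-cong {s = s} refl m , λ q q≢5 _ → regs≡ q q≢5
      where
      -- If c is free at u, failure means that the scan passed the end of the list, so the cell l of
      -- w was rejected; but w is acceptable.
      stuck : ∀ w → Adj G u w → f u w ≡ nothing → ¬ (Free f c u × Free f c w)
      stuck w uw none (free-u , free-w) = proj₂ (ps l<i) (C≡0 , F≡0)
        where
        l = mem s 3 (toℕ u) (toℕ w)
        l<D = proj₁ (position (neighbours m u) uw)
        Ll≡w = proj₂ (position (neighbours m u) uw)
        i≮D : ¬ (suc i ≤ D (toℕ u) 0)
        i≮D i<D = ¬success (i<D , unset (colors m) free-u)
        l<i : l < i
        l<i = <-≤-trans l<D (≮⇒≥ i≮D)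
        C≡0 : C (toℕ u) (L (toℕ u) l) ≡ 0
        C≡0 = trans (cong (C (toℕ u)) Ll≡w) (trans (table (colors m) u w) (cong encode none))
        F≡0 : F (L (toℕ u) l) (suc (toℕ c)) ≡ 0
        F≡0 = trans (cong (λ x → F x (suc (toℕ c))) Ll≡w) (unset (colors m) free-w)
 
 

-- Correctness of the updates

memory-⇔ : ∀ {k n} {A A′ : Fin n → Fin n → Set} {f : Table k n} {s} →
           (∀ {x y} → A x y → A′ x y) → (∀ {x y} → A′ x y → A x y) → Memory A f s → Memory A′ f s
memory-⇔ to from (memory nb cs) = memory (λ x → row-cong to from (λ _ → refl) (λ _ → refl) refl (nb x)) cs

Linked : ∀ {k n} → Reg → Reg → Fin n → Fin n → (Fin n → Fin n → Set) → Table k n → State → Set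
Linked a b u v A f s =
  ∃[ s′ ] (link a b , s ⇓ s′ , 3 × Memory (λ x y → A x y ⊎ (x ≡ u × y ≡ v)) f s′ × regs s′ ≡ regs s)

link-run : ∀ {k n} {A : Fin n → Fin n → Set} {f : Table k n} {s a b u v} → Memory A f s →
           regs s a ≡ toℕ u → regs s b ≡ toℕ v → ¬ A u v →
           Linked a b u v A f s
link-run {A = A} {s = s} {a} {b} {u} {v} (memory nb cs) a≡u b≡v ¬a =
  _ , ⇓-seq ⇓-mem (⇓-seq ⇓-mem ⇓-mem) , memory (linked a≡u b≡v) cs , refl
  where
  L = mem s 2
  P = mem s 3
  D = mem s 4
  linked : ∀ {x y} → x ≡ toℕ u → y ≡ toℕ v → Neighbours (λ x y → A x y ⊎ (x ≡ u × y ≡ v))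
           (upd x (D x 0) y L) (upd x y (D x 0) P) (upd x 0 (suc (D x 0)) D)
  linked refl refl = neighbours-link {L = L} {P} {D} nb ¬a

Unlinked : ∀ {k n} → Reg → Reg → Fin n → Fin n → (Fin n → Fin n → Set) → Table k n → State → Set
Unlinked a b u v A f s =
  ∃[ s′ ] (unlink a b , s ⇓ s′ , 4 × Memory (λ x y → A x y × ¬ (x ≡ u × y ≡ v)) f s′ ×
           (∀ q → q ≢ 5 → regs s′ q ≡ regs s q))

unlink-run : ∀ {k n} {A : Fin n → Fin n → Set} {f : Table k n} {s a b u v} → a ≢ 5 → b ≢ 5 → Memory A f s →
             regs s a ≡ toℕ u → regs s b ≡ toℕ v → A u v →
             Unlinked a b u v A f s
unlink-run {A = A} {s = s} {a} {b} {u} {v} a≢5 b≢5 (memory nb cs) a≡u b≡v uv =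
  _ , ⇓-seq ⇓-reg (⇓-seq ⇓-mem (⇓-seq ⇓-mem ⇓-mem)) ,
  memory (unlinked (trans (set-miss (regs s) a≢5) a≡u) (trans (set-miss (regs s) b≢5) b≡v)
                   (cong (λ x → L x (pred (D x 0))) a≡u)) cs ,
  λ q → set-miss (regs s)
  where
  L = mem s 2
  P = mem s 3
  D = mem s 4
  unlinked : ∀ {x y l} → x ≡ toℕ u → y ≡ toℕ v → l ≡ L (toℕ u) (pred (D (toℕ u) 0)) →
             Neighbours (λ x y → A x y × ¬ (x ≡ u × y ≡ v))
               (upd x (P x y) l L) (upd x l (P x y) P) (upd x 0 (pred (D x 0)) D)
  unlinked refl refl refl = neighbours-unlink {L = L} {P} {D} nb uv

record Invariant (k : ℕ) {n} (G : Graph n) (s : State) (f : Table k n) : Set where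
  field
    valid   : Valid G f
    maximal : Maximal G f
    store   : Memory (Adj G) f s
    bound   : regs s 0 ≡ k

open Invariant

Outcome : ∀ {k n} {G : Graph n} → Table k n → Update G → (State → ℕ → Set) → ℕ → Set
Outcome {k} {G = G} f x Run limit =
  ∃[ s′ ] ∃[ t ] ∃[ f′ ] (Run s′ t × t ≤ limit × GreedyStep x f f′ × Invariant k (G ▷ x) s′ f′)

colorInserted-run :
  ∀ {k n} {G : Graph n} {s f} u v (u≢v : u ≢ v) (¬a : ¬ Adj G u v) →
  let x = insert u v u≢v ¬a in
  Valid G f → Maximal G f → Memory (Adj (G ▷ x)) f s →
  regs s 0 ≡ k → regs s 2 ≡ toℕ u → regs s 3 ≡ toℕ v →
  Outcome {k} f x (λ s′ t → colorInserted , s ⇓ s′ , t) (8 + 4 * Δ (G ▷ x))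
colorInserted-run {k} {n} {G} {s} {f} u v u≢v ¬a f-valid₀ f-maximal m r₀ r₂ r₃ =
  finish (search-run P? {colorRejected} {s} test k (λ p → <-irrefl refl (proj₁ p)))
  where
  G′ = G ▷ insert u v u≢v ¬a

  f-valid : Valid G′ f
  f-valid = insert-valid f-valid₀ u≢v ¬a

  none : f u v ≡ nothing
  none = table-off f-valid₀ u v ¬a

  F = mem s 1

  Rejected : ℕ → ℕ → ℕ → ℕ → Set
  Rejected k x y i = suc i ≤ k × ¬ (F x (suc i) ≡ 0 × F y (suc i) ≡ 0)

  P : ℕ → Set
  P = Rejected k (toℕ u) (toℕ v)

  rejected? : ∀ k x y i → Dec (Rejected k x y i)
  rejected? k x y i = (suc i ≤? k) ×-dec ¬? ((F x (suc i) ≟ 0) ×-dec (F y (suc i) ≟ 0))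

  P? : ∀ i → Dec (P i)
  P? = rejected? k (toℕ u) (toℕ v)

  test : ∀ {s₁} → SameBut5 s s₁ → evalT colorRejected s₁ ≡ does (P? (regs s₁ 5))
  test {s₁} (same regs≡ refl) = trans
    (cong₂ (λ k x → does (rejected? k x (regs s₁ 3) (regs s₁ 5))) (trans (regs≡ 0 λ ()) r₀) (trans (regs≡ 2 λ ()) r₂))
    (cong (λ y → does (rejected? k (toℕ u) y (regs s₁ 5))) (trans (regs≡ 3 λ ()) r₃))

  blocked : ∀ {i} c → toℕ c ≡ i → P i → ¬ (Free f c u × Free f c v)
  blocked c refl p (free-u , free-v) =
    proj₂ p (unset (colors m) free-u , unset (colors m) free-v)

  -- The colours passed by the scan are an initial segment, all blocked; this is `blocked≤degrees`
  -- with j the final index.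
  index≤2Δ : ∀ {s₂} → Found P s s₂ → regs s₂ 5 ≤ Δ G′ + Δ G′
  index≤2Δ {s₂} found = ≤-trans
    (blocked≤degrees f (table-proper f-valid) (index≤k (before found)) λ i →
      blocked (inject≤ i _) (Fin.toℕ-inject≤ i _) (before found (Fin.toℕ<n i)))
    (+-mono-≤ (coloredDegree≤Δ f-valid u) (coloredDegree≤Δ f-valid v))
    where
    index≤k : ∀ {j} → (∀ {l} → l < j → P l) → j ≤ k
    index≤k {zero}  ps = z≤n
    index≤k {suc j} ps = proj₁ (ps (n<1+n j))

  Goal : State → ℕ → Set
  Goal s₃ t = ∃[ f′ ] (t ≤ 5 × GreedyStep (insert u v u≢v ¬a) f f′ × Invariant k G′ s₃ f′)

  branch : ∀ s₂ → Found P s s₂ → ∃[ s₃ ] ∃[ t ]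
           ((If reg 4 <= reg 0 Then paint 2 3 Else skip) , setReg 4 (suc (regs s₂ 5)) s₂ ⇓ s₃ , t × Goal s₃ t)
  branch s₂@(⟨ ρ , _ ⟩) record { others = same regs≡ refl ; fails = ¬p ; before = ps } =
    If-run (suc i ≤? k) (cong (λ k → does (suc i ≤? k)) ρ0≡k) Goal colored uncolored
    where
    i = ρ 5
    s₂′ = setReg 4 (suc i) s₂

    ρ0≡k : ρ 0 ≡ k
    ρ0≡k = trans (regs≡ 0 λ ()) r₀

    colored : suc i ≤ k → ∃[ s₃ ] ∃[ t ] (paint 2 3 , s₂′ ⇓ s₃ , t × Goal s₃ (suc t))
    colored i<k with paint-run {s = s₂′} {2} {3} {u} {v} (memory-cong {s = s} refl m) (table-sym f-valid)
                       (trans (regs≡ 2 λ ()) r₂) (trans (regs≡ 3 λ ()) r₃) (cong suc (sym (Fin.toℕ-fromℕ< i<k))) none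
    ... | s₃ , run , m₃ , regs₃ =
      s₃ , 4 , run , assign u v (just c) f , ≤-refl , step ,
      record { valid   = color-valid f-valid (inj₂ (inj₁ (refl , refl))) free-u free-v
             ; maximal = greedyStep-maximal f-valid₀ f-maximal step
             ; store   = m₃
             ; bound   = trans (cong (λ r → r 0) regs₃) ρ0≡k }
      where
      c = fromℕ< i<k
      c≡i : toℕ c ≡ i
      c≡i = Fin.toℕ-fromℕ< i<k
      accepted : F (toℕ u) (suc i) ≡ 0 × F (toℕ v) (suc i) ≡ 0
      accepted = decidable-stable ((F _ _ ≟ 0) ×-dec (F _ _ ≟ 0)) λ ¬acc → ¬p (i<k , ¬acc)
      free-u : Free f c u
      free-u = unused (colors m) (trans (cong (F (toℕ u) ∘ suc) c≡i) (proj₁ accepted))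
      free-v : Free f c v
      free-v = unused (colors m) (trans (cong (F (toℕ v) ∘ suc) c≡i) (proj₂ accepted))
      step : GreedyStep (insert u v u≢v ¬a) f (assign u v (just c) f)
      step = insert-colored c free-u free-v λ _ _ → refl

    uncolored : ¬ (suc i ≤ k) → ∃[ s₃ ] ∃[ t ] (skip , s₂′ ⇓ s₃ , t × Goal s₃ (suc t))
    uncolored i≮k = s₂′ , 1 , ⇓-skip , f , s≤s (s≤s z≤n) , step ,
      record { valid = f-valid ; maximal = greedyStep-maximal f-valid₀ f-maximal step
             ; store = memory-cong {s = s} refl m ; bound = ρ0≡k }
      where
      step : GreedyStep (insert u v u≢v ¬a) f f
      step = insert-uncolored (λ c → blocked c refl (ps (<-≤-trans (Fin.toℕ<n c) (≮⇒≥ i≮k)))) λ _ _ → refl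

  finish : ∃[ s₂ ] ∃[ t ] (searchFrom0 colorRejected , s ⇓ s₂ , t × Found P s s₂ × t ≡ 2 + 2 * regs s₂ 5) →
           Outcome {k} f (insert u v u≢v ¬a) (λ s′ t → colorInserted , s ⇓ s′ , t) (8 + 4 * Δ G′)
  finish (s₂ , t₂ , run₂ , found , time₂) with branch s₂ found
  ... | s₃ , t₃ , run₃ , f′ , time₃ , step , inv′ =
    s₃ , t₂ + (1 + t₃) , f′ , ⇓-seq run₂ (⇓-seq ⇓-reg run₃) , total (Δ G′) time₂ (index≤2Δ found) time₃ , step , inv′
    where
    -- Beyond the search there are one assignment, one test and four writes.
    total : ∀ {t₂ t₃ j} d → t₂ ≡ 2 + 2 * j → j ≤ d + d → t₃ ≤ 5 → t₂ + (1 + t₃) ≤ 8 + 4 * d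
    total d refl j≤2d t₃≤5 = ≤-trans
      (+-mono-≤ (+-monoʳ-≤ 2 (*-monoʳ-≤ 2 j≤2d)) (+-monoʳ-≤ 1 t₃≤5)) (≤-reflexive (collect d))
      where
      collect : ∀ d → 2 + 2 * (d + d) + 6 ≡ 8 + 4 * d
      collect = solve-∀

TriedBoth : ∀ {k n} → Graph n → Fin k → Fin n → Fin n → Table k n → State → Set
TriedBoth {k} {n} G c u v f s =
  ∃[ s′ ] ∃[ t ] ∃[ g ] ∃[ f′ ] ((tryPaint 2 ⨟ tryPaint 3) , s ⇓ s′ , t × t ≤ 16 + 4 * Δ G ×
    TryColor G c u f g × TryColor G c v g f′ × Valid G f′ × Memory (Adj G) f′ s′ × regs s′ 0 ≡ regs s 0)

tryPaint-both : ∀ {k n} {G : Graph n} {f : Table k n} {s u v c} → Valid G f → Memory (Adj G) f s →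
                regs s 2 ≡ toℕ u → regs s 3 ≡ toℕ v → regs s 4 ≡ suc (toℕ c) → TriedBoth G c u v f s
tryPaint-both {k} {G = G} {f} {s} {u} {v} {c} f-valid m r₂ r₃ r₄ =
  second (tryPaint-run {a = 2} (λ ()) (λ ()) f-valid m r₂ r₄)
  where
  sum-of-times : ∀ {t₁ t₂} d → t₁ ≤ 8 + 2 * d → t₂ ≤ 8 + 2 * d → t₁ + t₂ ≤ 16 + 4 * d
  sum-of-times d t₁≤ t₂≤ = ≤-trans (+-mono-≤ t₁≤ t₂≤) (≤-reflexive (collect d))
    where
    collect : ∀ d → 8 + 2 * d + (8 + 2 * d) ≡ 16 + 4 * d
    collect = solve-∀

  second : Tried G c 2 u f s → TriedBoth G c u v f s
  second (s₁ , t₁ , g , run₁ , time₁ , try-u , m₁ , regs₁) =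
    finish (tryPaint-run {a = 3} (λ ()) (λ ()) g-valid m₁
              (trans (regs₁ 3 (λ ()) λ ()) r₃) (trans (regs₁ 4 (λ ()) λ ()) r₄))
    where
    g-valid : Valid G g
    g-valid = tryColor-valid f-valid try-u
    finish : Tried G c 3 v g s₁ → TriedBoth G c u v f s
    finish (s₂ , t₂ , f′ , run₂ , time₂ , try-v , m₂ , regs₂) =
      s₂ , t₁ + t₂ , g , f′ , ⇓-seq run₁ run₂ , sum-of-times (Δ G) time₁ time₂ ,
      try-u , try-v , tryColor-valid g-valid try-v , m₂ ,
      trans (regs₂ 0 (λ ()) λ ()) (regs₁ 0 (λ ()) λ ())

recolorDeleted-run :
  ∀ {k n} {G : Graph n} {s f} u v (a : Adj G u v) →
  let x = delete u v a in
  Valid G f → Maximal G f → Memory (Adj (G ▷ x)) f s →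
  regs s 0 ≡ k → regs s 2 ≡ toℕ u → regs s 3 ≡ toℕ v →
  Outcome {k} f x (λ s′ t → recolorDeleted , s ⇓ s′ , t) (22 + 4 * Δ (G ▷ x))
recolorDeleted-run {k} {n} {G} {s} {f} u v a f-valid f-maximal m r₀ r₂ r₃ = branch (f u v) refl
  where
  G′ = G ▷ delete u v a

  s₂ : State
  s₂ = setReg 4 (mem s 0 (regs s 2) (regs s 3)) s

  m₂ : Memory (Adj G′) f s₂
  m₂ = memory-cong {s = s} refl m

  r₄ : regs s₂ 4 ≡ encode (f u v)
  r₄ = trans (cong₂ (mem s 0) r₂ r₃) (table (colors m) u v)

  Result : Set
  Result = Outcome {k} f (delete u v a) (λ s′ t → recolorDeleted , s ⇓ s′ , t) (22 + 4 * Δ G′)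

  branch : ∀ c → f u v ≡ c → Result
  branch nothing none =
    s₂ , 3 , f , ⇓-seq ⇓-reg (⇓-true (cong (_≡ᵇ 0) (trans r₄ (cong encode none))) ⇓-skip) , s≤s (s≤s (s≤s z≤n)) , step ,
    record { valid   = record { table-sym    = table-sym f-valid
                              ; table-off    = still-off
                              ; table-proper = table-proper f-valid }
           ; maximal = greedyStep-maximal f-valid f-maximal step
           ; store   = m₂
           ; bound   = r₀ }
    where
    step : GreedyStep (delete u v a) f f
    step = delete-uncolored none λ _ _ → refl
    -- The deleted pair is the only new non-edge, and it was uncoloured.
    still-off : ∀ x y → ¬ Adj G′ x y → f x y ≡ nothing
    still-off x y ¬a′ with sameEdge? u v x y
    ... | yes e = trans (constant-on-edge (table-sym f-valid) e) none
    ... | no ¬e = table-off f-valid x y λ a → ¬a′ (a , ¬e)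
  branch (just c) uv =
    recolor (erase-run {s = s₂} {2} {3} m₂ (table-sym f-valid) (table-proper f-valid) r₂ r₃ r₄≡c uv)
    where
    r₄≡c : regs s₂ 4 ≡ suc (toℕ c)
    r₄≡c = trans r₄ (cong encode uv)

    recolor : ∃[ s₃ ] (erase 2 3 , s₂ ⇓ s₃ , 4 × Memory (Adj G′) (assign u v nothing f) s₃ × regs s₃ ≡ regs s₂) → Result
    recolor (s₃ , run₃ , m₃ , regs₃) =
      finish (tryPaint-both (delete-valid f-valid a) m₃ (trans (cong (λ r → r 2) regs₃) r₂)
                (trans (cong (λ r → r 3) regs₃) r₃) (trans (cong (λ r → r 4) regs₃) r₄≡c))
      where
      finish : TriedBoth G′ c u v (assign u v nothing f) s₃ → Result
      finish (s₅ , t , g , f′ , run , time , try-u , try-v , valid′ , m₅ , reg₀) =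
        -- One step to read the colour, one test and four writes of `erase`; with the two attempts
        -- this makes 22 = 6 + 16.
        s₅ , suc (suc (4 + t)) , f′ , ⇓-seq ⇓-reg (⇓-false (cong (_≡ᵇ 0) r₄≡c) (⇓-seq run₃ run)) , +-monoʳ-≤ 6 time , step ,
        record { valid   = valid′
               ; maximal = greedyStep-maximal f-valid f-maximal step
               ; store   = m₅
               ; bound   = trans reg₀ (trans (cong (λ r → r 0) regs₃) r₀) }
        where
        step : GreedyStep (delete u v a) f f′
        step = delete-colored c g uv try-u try-v

-- The constant comes from deletions: 8 steps of unlinking and 22 of recolouring, apart from the
-- multiple of Δ. The successor covers this fixed cost when Δ = 0.
greedy-step : ∀ {k n} {G : Graph n} {s f} → Invariant k G s f → (x : Update G) →
              Outcome {k} f x (Process greedy x s) (30 * suc (Δ (G ▷ x)))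
greedy-step {k} {n} {G} {s} {f} inv x@(insert u v u≢v ¬a) =
  second (link-run {s = load u v s} {2} {3} (memory-cong {s = s} refl (store inv)) refl refl ¬a)
  where
  Result : Set
  Result = Outcome {k} f x (Process greedy x s) (30 * suc (Δ (G ▷ x)))

  total : ∀ {t} d → t ≤ 8 + 4 * d → 6 + t ≤ 30 * suc d
  total d t≤ = ≤-trans (+-monoʳ-≤ 6 t≤) (m+n≤o⇒m≤o _ (≤-reflexive (slack d)))
    where
    slack : ∀ d → 6 + (8 + 4 * d) + (16 + 26 * d) ≡ 30 * suc d
    slack = solve-∀

  second : Linked 2 3 u v (Adj G) f (load u v s) → Result
  second (s₁ , run₁ , m₁ , regs₁) =
    color-edge (link-run {a = 3} {2} m₁ (cong (λ r → r 3) regs₁) (cong (λ r → r 2) regs₁)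
      λ { (inj₁ a) → ¬a (adj-sym G a) ; (inj₂ (v≡u , _)) → u≢v (sym v≡u) })
    where
    color-edge : Linked 3 2 v u (λ x y → Adj G x y ⊎ (x ≡ u × y ≡ v)) f s₁ → Result
    color-edge (s₂ , run₂ , m₂ , regs₂) =
      finish (colorInserted-run u v u≢v ¬a (valid inv) (maximal inv)
        (memory-⇔
          (λ { (inj₁ (inj₁ a)) → inj₁ a ; (inj₁ (inj₂ e)) → inj₂ (inj₁ e) ; (inj₂ e) → inj₂ (inj₂ e) })
          (λ { (inj₁ a) → inj₁ (inj₁ a) ; (inj₂ (inj₁ e)) → inj₁ (inj₂ e) ; (inj₂ (inj₂ e)) → inj₂ e }) m₂)
        (trans (kept 0) (bound inv)) (kept 2) (kept 3))
      where
      kept : ∀ q → regs s₂ q ≡ regs (load u v s) q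
      kept q = trans (cong (λ r → r q) regs₂) (cong (λ r → r q) regs₁)
      finish : Outcome {k} f x (λ s′ t → colorInserted , s₂ ⇓ s′ , t) (8 + 4 * Δ (G ▷ x)) → Result
      finish (s₃ , t , f′ , run , time , step , inv′) =
        s₃ , 6 + t , f′ , ⇓-seq (⇓-seq run₁ run₂) run , total (Δ (G ▷ x)) time , step , inv′
greedy-step {k} {n} {G} {s} {f} inv x@(delete u v a) =
  second (unlink-run {s = load u v s} {2} {3} (λ ()) (λ ()) (memory-cong {s = s} refl (store inv)) refl refl a)
  where
  Result : Set
  Result = Outcome {k} f x (Process greedy x s) (30 * suc (Δ (G ▷ x)))

  total : ∀ {t} d → t ≤ 22 + 4 * d → 8 + t ≤ 30 * suc d
  total d t≤ = ≤-trans (+-monoʳ-≤ 8 t≤) (m+n≤o⇒m≤o _ (≤-reflexive (slack d)))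
    where
    slack : ∀ d → 8 + (22 + 4 * d) + 26 * d ≡ 30 * suc d
    slack = solve-∀

  second : Unlinked 2 3 u v (Adj G) f (load u v s) → Result
  second (s₁ , run₁ , m₁ , regs₁) =
    recolor (unlink-run {a = 3} {2} (λ ()) (λ ()) m₁ (regs₁ 3 λ ()) (regs₁ 2 λ ())
      (adj-sym G a , λ (v≡u , _) → irrefl G (subst (Adj G u) v≡u a)))
    where
    recolor : Unlinked 3 2 v u (λ x y → Adj G x y × ¬ (x ≡ u × y ≡ v)) f s₁ → Result
    recolor (s₂ , run₂ , m₂ , regs₂) =
      finish (recolorDeleted-run u v a (valid inv) (maximal inv)
        (memory-⇔ (λ ((a , ¬e) , ¬e′) → a , [ ¬e , ¬e′ ]′) (λ (a , ¬e) → (a , ¬e ∘ inj₁) , ¬e ∘ inj₂) m₂)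
        (trans (kept 0 λ ()) (bound inv)) (kept 2 λ ()) (kept 3 λ ()))
      where
      kept : ∀ q → q ≢ 5 → regs s₂ q ≡ regs (load u v s) q
      kept q q≢5 = trans (regs₂ q q≢5) (regs₁ q q≢5)
      finish : Outcome {k} f x (λ s′ t → recolorDeleted , s₂ ⇓ s′ , t) (22 + 4 * Δ (G ▷ x)) → Result
      finish (s₃ , t , f′ , run , time , step , inv′) =
        s₃ , 8 + t , f′ , ⇓-seq (⇓-seq run₁ run₂) run , total (Δ (G ▷ x)) time , step , inv′

-- The invariant in all reachable states

initial-invariant : ∀ k n → Invariant k emptyGraph (initial k n) (λ (_ _ : Fin n) → nothing)
initial-invariant k n .valid = record
  { table-sym = λ _ _ → refl ; table-off = λ _ _ _ → refl ; table-proper = λ () }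
initial-invariant k n .maximal ()
initial-invariant k n .store .neighbours x = record { entry = λ () ; position = λ () }
initial-invariant k n .store .colors = record
  { table = λ _ _ → refl ; unused = λ _ _ () ; unset = λ _ → refl }
initial-invariant k n .bound = refl

process-deterministic : ∀ {n} {G : Graph n} {alg s s₁ s₂ t₁ t₂} (x : Update G) →
                        Process alg x s s₁ t₁ → Process alg x s s₂ t₂ → s₁ ≡ s₂
process-deterministic (insert _ _ _ _) p q = proj₁ (⇓-deterministic p q)
process-deterministic (delete _ _ _)   p q = proj₁ (⇓-deterministic p q)

-- `Reachable` supplies an arbitrary run while `greedy-step` constructs one; determinism identifies
-- their final states.
reachable-invariant : ∀ {k n} {G : Graph n} {s} → Reachable greedy k n G s → ∃[ f ] Invariant k G s f
reachable-invariant {k} {n} start = _ , initial-invariant k n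
reachable-invariant (next reachable x run) with reachable-invariant reachable
... | f , inv with greedy-step inv x
...   | s₁ , _ , f′ , run₁ , _ , _ , inv′ with process-deterministic x run run₁
...     | refl = f′ , inv′

theorem14 : ∃[ alg ] ∃[ C ]
    ((k : ℕ) → .{{_ : NonZero k}} → (n : ℕ) (G : Graph n) (s : State) →
    Reachable alg k n G s →
    ∃[ f ]
    (Represents {k} {n} {G} s f
    × IsApproximation 1+2√3/3 f
    × ((x : Update G) →
    ∃[ s′ ] ∃[ t ] ∃[ f′ ]
    (Process alg x s s′ t
    × t ≤ C * suc (Δ (G ▷ x))
    × Represents {k} {n} {G ▷ x} s′ f′
    × GreedyStep x (color f) (color f′)))))
theorem14 = greedy , 30 , λ k n G s reachable →
  let f , inv = reachable-invariant reachable in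
  toColoring (valid inv) , table (colors (store inv)) , maximal⇒approximation (toColoring (valid inv)) (maximal inv) ,
  λ x → let s′ , t , f′ , run , time , step , inv′ = greedy-step inv x in
    s′ , t , toColoring (valid inv′) , run , time , table (colors (store inv′)) , step
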